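{- Let $\mathbb{F}_q$ be a finite field with $q$ elements, let $P(X,Z)\in\mathbb{F}_q[X,Z]$ be monic in $Z$ with $\deg_Z P\ge 2$, and let $Q(X,Y,Z)\in\mathbb{F}_q[X,Y,Z]$ be monic in $Y$ with $\deg_Y Q\ge 2$. Let $$N_0'=\#\{(\beta,\gamma)\in\mathbb{F}_q^2\mid P(0,\gamma)=0,\ Q(0,\beta,\gamma)=0\}.$$ Let $\gamma_1,\dots,\gamma_r$ be the distinct roots of $P(0,Z)$ in $\mathbb{F}_q$. Let $R(Y,Z)\in\mathbb{F}_q[Y,Z]$ be the unique polynomial satisfying $R(Y,Z)\equiv Q(0,Y,Z)\pmod{Y^q-Y}$ and $\deg_Y R\le q-1$. Write $$R(Y,Z)=\sum_{i=0}^{q-1}a_i(Z)Y^i,\qquad R_{\gamma_j}(Y):=R(Y,\gamma_j)=\sum_{i=0}^{q-1}a_i(\gamma_j)Y^i.$$ After reindexing if necessary, assume that $a_0(\gamma_j)=0$ for $1\le j\le t$ and $a_0(\gamma_j)\ne 0$ for $t+1\le j\le r$. For each $j=1,\dots,r$ define $$S_{\gamma_j}(Y)=\begin{cases}\dfrac{R_{\gamma_j}(Y)}{Y}, & \text{if } a_0(\gamma_j)=0,\\[1ex] \bigl(a_0(\gamma_j)+a_{q-1}(\gamma_j)\bigr)+a_1(\gamma_j)Y+\cdots+a_{q-2}(\gamma_j)Y^{q-2}, & \text{if } a_0(\gamma_j)\neq 0,\end{cases}$$ and let $\rho_{\gamma_j}$ denote the rank of the left circulant matrix associated with $S_{\gamma_j}(Y)$.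 Then $$N_0'=r(q-1)-\sum_{j=1}^r\rho_{\gamma_j}+t.$$
   Context: For a polynomial $f(Y)=c_0+c_1Y+\cdots+c_{q-2}Y^{q-2}\in\mathbb{F}_q[Y]$ (degree at most $q-2$), the left circulant matrix associated with $f$ is the $(q-1)\times(q-1)$ matrix $(c_{i+j})_{0\le i,j\le q-2}$ over $\mathbb{F}_q$, with indices taken modulo $q-1$. "Monic in $Z$" means leading coefficient $1$ as a polynomial in $Z$ over the polynomial ring in the other variables; similarly for $Y$. -}

module Defs where

open import Algebra.Apartness.Bundles using (HeytingField; HeytingCommutativeRing)
open import Algebra.Bundles using (CommutativeRing; RawRing)
import Algebra.Definitions.RawSemiring as RawSemiringDefinitions
open import Data.Bool.Base using (if_then_else_)
open import Data.Fin.Base using (Fin; toℕ)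
open import Data.Fin.Properties using (nonZeroIndex) renaming (_≟_ to _≟ᶠ_)
open import Data.List.Base using (List; []; _∷_; map; drop; length; filter; applyUpTo; allFin; cartesianProduct)
open import Data.Nat.Base as ℕ using (ℕ; zero; suc; _∸_; _≤_; _<_)
open import Data.Nat.DivMod using (_%_)
open import Data.Product.Base using (_×_; _,_; ∃-syntax)
open import Data.Vec.Functional using (Vector)
open import Function.Bundles using (Inverse)
open import Function.Properties.Inverse using (Inverse⇒Injection)
open import Level using (Level; _⊔_)
open import Relation.Binary.Bundles using (Setoid)
open import Relation.Binary.Definitions using (Decidable)
open import Relation.Binary.PropositionalEquality using (setoid)
open import Relation.Nullary.Decidable using (does; _×-dec_; via-injection)

-- A polynomial is the list of its coefficients, constant term first.
-- Trailing zeros are allowed, so equality is equality of all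
-- coefficients.  Iterating `polyRing` gives polynomials in several
-- variables, e.g. A[X,Z] as A[X][Z].

module Polynomial {c ℓ : Level} (A : RawRing c ℓ) where
  open RawRing A

  Poly : Set c
  Poly = List Carrier

  coeff : Poly → ℕ → Carrier
  coeff []      _       = 0#
  coeff (a ∷ p) zero    = a
  coeff (a ∷ p) (suc n) = coeff p n

  eval : Poly → Carrier → Carrier
  eval []      x = 0#
  eval (a ∷ p) x = a + x * eval p x

  addᴾ : Poly → Poly → Poly
  addᴾ []      g       = g
  addᴾ (a ∷ f) []      = a ∷ f
  addᴾ (a ∷ f) (b ∷ g) = (a + b) ∷ addᴾ f g

  mulᴾ : Poly → Poly → Poly
  mulᴾ []      g = []
  mulᴾ (a ∷ f) g = addᴾ (map (a *_) g) (0# ∷ mulᴾ f g)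

  polyRing : RawRing c ℓ
  polyRing = record
    { Carrier = Poly
    ; _≈_     = λ f g → ∀ n → coeff f n ≈ coeff g n
    ; _+_     = addᴾ
    ; _*_     = mulᴾ
    ; -_      = map (-_)
    ; 0#      = []
    ; 1#      = 1# ∷ []
    }

  var : Poly
  var = 0# ∷ 1# ∷ []

  DegreeAtMost : ℕ → Poly → Set ℓ
  DegreeAtMost d f = ∀ n → d < n → coeff f n ≈ 0#

  MonicOfDegree : ℕ → Poly → Set ℓ
  MonicOfDegree d f = coeff f d ≈ 1# × DegreeAtMost d f

module LinearAlgebra {c ℓ : Level} (A : RawRing c ℓ) where
  open RawRing A
  open RawSemiringDefinitions rawSemiring using (sum)

  Matrix : ℕ → ℕ → Set c
  Matrix m n = Fin m → Fin n → Carrier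

  linearCombination : ∀ {k m} → Vector Carrier k → Vector (Vector Carrier m) k → Vector Carrier m
  linearCombination a v i = sum (λ l → a l * v l i)

  InSpan : ∀ {k m} → Vector (Vector Carrier m) k → Vector Carrier m → Set (c ⊔ ℓ)
  InSpan v w = ∃[ a ] (∀ i → linearCombination a v i ≈ w i)

  LinearlyIndependent : ∀ {k m} → Vector (Vector Carrier m) k → Set (c ⊔ ℓ)
  LinearlyIndependent v = ∀ a → (∀ i → linearCombination a v i ≈ 0#) → ∀ l → a l ≈ 0#

  -- v is a basis of the subspace spanned by the family u.
  IsBasisOfSpan : ∀ {k n m} → Vector (Vector Carrier m) k → Vector (Vector Carrier m) n → Set (c ⊔ ℓ)
  IsBasisOfSpan v u = (∀ l → InSpan u (v l)) × (∀ j → InSpan v (u j)) × LinearlyIndependent v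

  -- The rank is the dimension of the column space; over a field the
  -- number ρ is determined by M.
  HasRank : ∀ {m n} → Matrix m n → ℕ → Set (c ⊔ ℓ)
  HasRank {m} M ρ = ∃[ v ] IsBasisOfSpan {ρ} {m = m} v (λ j i → M i j)

fieldSetoid : ∀ {c ℓ₁ ℓ₂} → HeytingField c ℓ₁ ℓ₂ → Setoid c ℓ₁
fieldSetoid F = CommutativeRing.setoid (HeytingCommutativeRing.commutativeRing (HeytingField.heytingCommutativeRing F))

-- The library's field is the Heyting field (distinct elements are
-- "apart", and apartness means invertible difference).  Under a
-- bijection with Fin q equality and invertibility are decidable, so
-- that x # y is equivalent to ¬ x ≈ y and this is a field with q
-- elements in the usual sense.

module FiniteField
  {c ℓ₁ ℓ₂ : Level} (F : HeytingField c ℓ₁ ℓ₂)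
  {q : ℕ} (enumeration : Inverse (fieldSetoid F) (setoid (Fin q)))
  where

  open HeytingField F public using (Carrier; _≈_; 0#; 1#)

  𝔽 : RawRing c ℓ₁
  𝔽 = CommutativeRing.rawRing (HeytingCommutativeRing.commutativeRing (HeytingField.heytingCommutativeRing F))

  infix 4 _≟_
  _≟_ : Decidable _≈_
  _≟_ = via-injection (Inverse⇒Injection enumeration) _≟ᶠ_

  elements : List Carrier
  elements = map (Inverse.from enumeration) (allFin q)

  𝔽[T] : RawRing c ℓ₁
  𝔽[T] = Polynomial.polyRing 𝔽

  𝔽[T][U] : RawRing c ℓ₁
  𝔽[T][U] = Polynomial.polyRing 𝔽[T]

  module P₁ = Polynomial 𝔽
  module P₂ = Polynomial 𝔽[T]
  module P₃ = Polynomial 𝔽[T][U]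

  -- P(0,Z) for P ∈ 𝔽[X][Z]
  P⟨0,Z⟩ : P₂.Poly → P₁.Poly
  P⟨0,Z⟩ = map (λ p → P₁.eval p 0#)

  -- Q(0,Y,Z) ∈ 𝔽[Z][Y] for Q ∈ 𝔽[X][Z][Y]
  Q⟨0,Y,Z⟩ : P₃.Poly → P₂.Poly
  Q⟨0,Y,Z⟩ = map P⟨0,Z⟩

  -- G(Y,γ) for G ∈ 𝔽[Z][Y]
  _⟨Y,_⟩ : P₂.Poly → Carrier → P₁.Poly
  G ⟨Y, γ ⟩ = map (λ a → P₁.eval a γ) G

  N₀′ : P₂.Poly → P₃.Poly → ℕ
  N₀′ P Q = length (filter
    (λ (β , γ) → (P₁.eval (P⟨0,Z⟩ P) γ ≟ 0#) ×-dec (P₁.eval (Q⟨0,Y,Z⟩ Q ⟨Y, γ ⟩) β ≟ 0#))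
    (cartesianProduct elements elements))

  -- R is the remainder of G ∈ 𝔽[Z][Y] modulo Y^q − Y.
  IsReduction : P₂.Poly → P₂.Poly → Set (c ⊔ ℓ₁)
  IsReduction G R = (Y ^ q + (- Y)) ∣ (R + (- G)) × P₂.DegreeAtMost (q ∸ 1) R
    where
    open RawRing 𝔽[T][U] using (_+_; -_; rawSemiring)
    open RawSemiringDefinitions rawSemiring using (_^_; _∣_)
    Y = P₂.var

  -- aᵢ(γ), where R = Σ aᵢ(Z) Yⁱ ∈ 𝔽[Z][Y]
  a⟨_⟩ : ℕ → P₂.Poly → Carrier → Carrier
  a⟨ i ⟩ R γ = P₁.eval (P₂.coeff R i) γ

  -- In the first case the constant coefficient of R(Y,γ) is 0, so
  -- dividing by Y amounts to dropping it.
  S : P₂.Poly → Carrier → P₁.Poly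
  S R γ = if does (a⟨ 0 ⟩ R γ ≟ 0#)
    then drop 1 (R ⟨Y, γ ⟩)
    else (a⟨ 0 ⟩ R γ + a⟨ q ∸ 1 ⟩ R γ) ∷ applyUpTo (λ i → a⟨ suc i ⟩ R γ) (q ∸ 2)
    where open HeytingField F using (_+_)

  open LinearAlgebra 𝔽 public using (Matrix; HasRank)

  leftCirculant : P₁.Poly → Matrix (q ∸ 1) (q ∸ 1)
  leftCirculant f i j = P₁.coeff f (_%_ (toℕ i ℕ.+ toℕ j) (q ∸ 1) {{nonZeroIndex i}})

Σℕ : ∀ {r} → Vector ℕ r → ℕ
Σℕ = RawSemiringDefinitions.sum ℕ.+-*-rawSemiring

-- For a root γ of P(0,Z), reducing modulo Y^q − Y does not change the zeros β of Q(0,Y,γ), and on F_q^*,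
-- where β^(q−1) = 1, R_γ and S_γ have the same zeros.  The zero β = 0 occurs exactly when a₀(γ) = 0, which
-- accounts for t.  The rest is the König–Rados theorem: the left circulant matrix of f sends the power vector
-- (β^j)_j to f(β) (β^(−j))_j.  Power vectors of distinct nonzero elements are independent, because
-- Σ_{i<q−1} y^i vanishes for y ≠ 0, 1 and equals −1 for y = 1.  So the (β^(−j))_j with f(β) ≠ 0 form a basis of the
-- column space, and the rank is the number of non-roots of f in F_q^*.

module Submission where

open import Defs
open import Algebra.Apartness.Bundles using (HeytingField; HeytingCommutativeRing)
open import Algebra.Bundles using (CommutativeMonoid; CommutativeRing; RawRing)
import Algebra.Definitions.RawMagma as RawMagmaDefinitions
import Algebra.Definitions.RawSemiring as RawSemiringDefinitions
open import Algebra.Morphism.Construct.Identity using (isRingHomomorphism)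
open import Algebra.Morphism.Structures using (IsRingHomomorphism)
open import Data.Bool.Base using (true; false; if_then_else_)
open import Data.Fin.Base using (Fin; zero; suc; toℕ; punchIn; punchOut; fromℕ; inject₁; combine; finToFun; funToFin)
open import Data.Fin.Properties
  using (any?; injective⇒≤; suc-injective; punchIn-injective; punchInᵢ≢i; punchIn-punchOut; punchOut-injective;
         finToFun-funToFin; funToFin-finToFin; toℕ-inject₁; toℕ-fromℕ; toℕ<n)
  renaming (_≟_ to _≟ᶠ_)
open import Data.Integer.Base as ℤ using (+_)
import Data.Integer.Properties as ℤ
open import Data.List.Base using ([]; _∷_; _++_; map; length; filter; tabulate; cartesianProduct; applyUpTo; drop)
open import Data.List.Properties using (filter-++; length-++; map-tabulate)
open import Data.Nat.Base as ℕ using (ℕ; zero; suc; _∸_; _≤_; _<_; z≤n; s≤s)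
open import Data.Nat.DivMod using (_%_; [m+n]%n≡m%n; m<n⇒m%n≡m)
import Data.Nat.Properties as ℕ
open import Data.Product.Base using (Σ; ∃-syntax; _×_; _,_; proj₁; proj₂)
open import Data.Vec.Functional using (Vector)
open import Function.Base using (_∘_; id)
open import Function.Bundles using (Inverse; _⇔_; mk⇔; Equivalence)
open import Function.Definitions using (Injective)
open import Relation.Binary.PropositionalEquality as ≡ using (_≡_; _≢_; setoid)
open import Relation.Nullary using (¬_; Dec; yes; no; does; contradiction; ¬?)
open import Relation.Nullary.Decidable using (does-⇔; decidable-stable; _×-dec_)
open import Relation.Unary using (Pred; Decidable)

import Algebra.Properties.CommutativeMonoid.Sum ℕ.+-0-commutativeMonoid as ∑ℕ

-- `HasRank` hands over an arbitrary basis of the column space, so exhibiting one explicit basis is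
-- not enough: any two bases must be shown to have the same size. Finiteness replaces elimination
-- here. Vectors of length k are encoded as elements of `Fin (q ^ k)`, so injective linear maps
-- become injections of finite sets: k independent vectors in the span of l vectors give q^k ≤ q^l,
-- hence k ≤ l, and d independent vectors in dimension d span because an injective self-map of a
-- finite set is surjective. The same pigeonhole turns multiplication by b ≠ 0 and translation by 1
-- into permutations, whence b^(q-1) = 1 and q·1 = 0; the latter is the origin of the constant -1,
-- since q - 1 ones and one more add up to 0. Each root γ contributes an identity free of
-- subtraction, (zeros of R_γ) + ρ_γ = (q - 1) + [a₀(γ) = 0], so the counting stays in ℕ and ℤ
-- enters only with the final statement.

injective⇒surjective : ∀ {n} (f : Fin n → Fin n) → Injective _≡_ _≡_ f → ∀ y → ∃[ x ] f x ≡ y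
injective⇒surjective {suc n} f inj y with any? (λ x → f x ≟ᶠ y)
... | yes found = found
-- A missed value could be punched out of the codomain, embedding `Fin (suc n)` into `Fin n`.
... | no missed = contradiction (injective⇒≤ {f = λ x → punchOut (avoids x)} punched-injective) ℕ.1+n≰n
  where
  avoids : ∀ x → y ≢ f x
  avoids x y≡fx = missed (x , ≡.sym y≡fx)

  punched-injective : Injective _≡_ _≡_ (λ x → punchOut (avoids x))
  punched-injective {x} {x′} = inj ∘ punchOut-injective (avoids x) (avoids x′)

-- Finite sums in a commutative monoid

module _ {c ℓ} (M : CommutativeMonoid c ℓ) where
  open CommutativeMonoid M hiding (setoid)
  open import Algebra.Properties.CommutativeMonoid.Sum M
  open import Relation.Binary.Reasoning.Setoid (CommutativeMonoid.setoid M)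

  sum-zero : ∀ {n} (t : Vector Carrier n) → (∀ k → t k ≈ ε) → sum t ≈ ε
  sum-zero {n} t t≈ε = trans (sum-cong-≋ t≈ε) (sum-replicate-zero n)

  sum-supported : ∀ {n} (t : Vector Carrier n) k → (∀ j → j ≢ k → t j ≈ ε) → sum t ≈ t k
  sum-supported t zero t≈ε = trans (∙-congˡ (sum-zero (t ∘ suc) (λ j → t≈ε (suc j) λ ()))) (identityʳ _)
  sum-supported t (suc k) t≈ε = trans
    (∙-cong (t≈ε zero λ ()) (sum-supported (t ∘ suc) k (λ j j≢k → t≈ε (suc j) (j≢k ∘ suc-injective))))
    (identityˡ _)

  -- Double counting of the array `g`, which has the entry `t k` where `e i ≡ k` and `ε` elsewhere:
  -- by injectivity each `k` meets at most one `i`. The monoid is arbitrary because the lemma serves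
  -- products and sums of field elements as well as counts in ℕ.
  sum-reindex : ∀ {m n} (e : Fin m → Fin n) → Injective _≡_ _≡_ e → (t : Vector Carrier n) →
                (∀ k → (∀ i → e i ≢ k) → t k ≈ ε) → sum t ≈ sum (t ∘ e)
  sum-reindex {m} {n} e inj t t≈ε = begin
    sum t                           ≈⟨ sum-cong-≋ row ⟨
    sum (λ k → sum (λ i → g i k))   ≈⟨ ∑-comm (λ k i → g i k) ⟩
    sum (λ i → sum (g i))           ≈⟨ sum-cong-≋ column ⟩
    sum (t ∘ e)                     ∎
    where
    g : Fin m → Fin n → Carrier
    g i k = if does (e i ≟ᶠ k) then t k else ε

    g-on : ∀ i {k} → e i ≡ k → g i k ≈ t k
    g-on i {k} eq with e i ≟ᶠ k
    ... | yes _ = refl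
    ... | no ≢k = contradiction eq ≢k

    g-off : ∀ i {k} → e i ≢ k → g i k ≈ ε
    g-off i {k} neq with e i ≟ᶠ k
    ... | yes ≡k = contradiction ≡k neq
    ... | no _ = refl

    column : ∀ i → sum (g i) ≈ t (e i)
    column i = trans (sum-supported (g i) (e i) (λ k k≢ → g-off i (k≢ ∘ ≡.sym))) (g-on i ≡.refl)

    row : ∀ k → sum (λ i → g i k) ≈ t k
    row k with any? (λ i → e i ≟ᶠ k)
    ... | yes (i , ei≡k) = trans
      (sum-supported (λ i′ → g i′ k) i (λ i′ i′≢i → g-off i′ (λ ei′≡k → i′≢i (inj (≡.trans ei′≡k (≡.sym ei≡k))))))
      (g-on i ei≡k)
    ... | no missed = trans
      (sum-zero _ (λ i → g-off i (λ eq → missed (i , eq))))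
      (sym (t≈ε k (λ i eq → missed (i , eq))))

-- Counting with indicators

𝟙 : ∀ {p} {P : Set p} → Dec P → ℕ
𝟙 P? = if does P? then 1 else 0

𝟙-cong : ∀ {p q} {P : Set p} {Q : Set q} → P ⇔ Q → (P? : Dec P) (Q? : Dec Q) → 𝟙 P? ≡ 𝟙 Q?
𝟙-cong P⇔Q P? Q? = ≡.cong (if_then 1 else 0) (does-⇔ P⇔Q P? Q?)

𝟙-false : ∀ {p} {P : Set p} (P? : Dec P) → ¬ P → 𝟙 P? ≡ 0
𝟙-false (yes p) ¬p = contradiction p ¬p
𝟙-false (no _)  _  = ≡.refl

𝟙-true : ∀ {p} {P : Set p} (P? : Dec P) → P → 𝟙 P? ≡ 1
𝟙-true (yes _) _ = ≡.refl
𝟙-true (no ¬p) p = contradiction p ¬p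

𝟙+𝟙¬≡1 : ∀ {p} {P : Set p} (P? : Dec P) → 𝟙 P? ℕ.+ 𝟙 (¬? P?) ≡ 1
𝟙+𝟙¬≡1 (yes _) = ≡.refl
𝟙+𝟙¬≡1 (no _)  = ≡.refl

sum-const : ∀ n c → ∑ℕ.sum {n} (λ _ → c) ≡ n ℕ.* c
sum-const zero    c = ≡.refl
sum-const (suc n) c = ≡.cong (c ℕ.+_) (sum-const n c)

-- This is where the reindexing convention of the theorem enters: the indices satisfying `P` form an
-- initial segment, so their number is `t`.
sum-𝟙-initial : ∀ {p} {r} {P : Fin r → Set p} (P? : ∀ j → Dec (P j)) t → t ≤ r →
                (∀ j → toℕ j < t → P j) → (∀ j → t ≤ toℕ j → ¬ P j) → ∑ℕ.sum (λ j → 𝟙 (P? j)) ≡ t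
sum-𝟙-initial {r = zero}  P? .0 z≤n below above = ≡.refl
sum-𝟙-initial {r = suc r} P? zero z≤n below above =
  ≡.cong₂ ℕ._+_ (𝟙-false (P? zero) (above zero z≤n))
    (sum-𝟙-initial (P? ∘ suc) zero z≤n (λ _ ()) (λ j _ → above (suc j) z≤n))
sum-𝟙-initial {r = suc r} P? (suc t) (s≤s t≤r) below above =
  ≡.cong₂ ℕ._+_ (𝟙-true (P? zero) (below zero (s≤s z≤n)))
    (sum-𝟙-initial (P? ∘ suc) t t≤r (λ j j<t → below (suc j) (s≤s j<t)) (λ j t≤j → above (suc j) (s≤s t≤j)))

length-filter-tabulate : ∀ {a p} {A : Set a} {P : Pred A p} (P? : Decidable P) {n} (f : Fin n → A) →
                         length (filter P? (tabulate f)) ≡ ∑ℕ.sum (λ i → 𝟙 (P? (f i)))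
length-filter-tabulate P? {zero}  f = ≡.refl
length-filter-tabulate P? {suc n} f with does (P? (f zero)) | length-filter-tabulate P? (f ∘ suc)
... | true  | ih = ≡.cong suc ih
... | false | ih = ih

length-filter-cartesianProduct :
  ∀ {a b p} {A : Set a} {B : Set b} {P : Pred (A × B) p} (P? : Decidable P) {m n} (f : Fin m → A) (g : Fin n → B) →
  length (filter P? (cartesianProduct (tabulate f) (tabulate g))) ≡ ∑ℕ.sum (λ i → ∑ℕ.sum (λ j → 𝟙 (P? (f i , g j))))
length-filter-cartesianProduct P? {zero}  f g = ≡.refl
length-filter-cartesianProduct P? {suc m} f g = begin
  length (filter P? (row ++ rest))                    ≡⟨ ≡.cong length (filter-++ P? row rest) ⟩
  length (filter P? row ++ filter P? rest)            ≡⟨ length-++ (filter P? row) ⟩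
  length (filter P? row) ℕ.+ length (filter P? rest)  ≡⟨ ≡.cong₂ (λ xs k → length (filter P? xs) ℕ.+ k)
                                                           (map-tabulate g (f zero ,_))
                                                           (length-filter-cartesianProduct P? (f ∘ suc) g) ⟩
  length (filter P? (tabulate (λ j → f zero , g j))) ℕ.+ _  ≡⟨ ≡.cong (ℕ._+ _) (length-filter-tabulate P? (λ j → f zero , g j)) ⟩
  _                                                   ∎
  where
  open ≡.≡-Reasoning
  row = map (f zero ,_) (tabulate g)
  rest = cartesianProduct (tabulate (f ∘ suc)) (tabulate g)

-- The domain is literally `Fin` of the count, so that a family of vectors indexed through `select`
-- has the number of selected indices as its length.
select : ∀ {p n} {P : Pred (Fin n) p} (P? : Decidable P) →
         Σ (Fin (∑ℕ.sum (λ k → 𝟙 (P? k))) → Fin n) λ e →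
           Injective _≡_ _≡_ e × (∀ i → P (e i)) × (∀ k → P k → ∃[ i ] e i ≡ k)
select {n = zero}  P? = (λ ()) , (λ { {()} }) , (λ ()) , (λ ())
select {n = suc n} P? with P? zero | select (P? ∘ suc)
... | no ¬p | e , inj , sound , complete =
  suc ∘ e , inj ∘ suc-injective , sound , complete′
  where
  complete′ : ∀ k → _ → _
  complete′ zero    p = contradiction p ¬p
  complete′ (suc k) p with complete k p
  ... | i , ≡.refl = i , ≡.refl
... | yes p | e , inj , sound , complete = e′ , inj′ , sound′ , complete′
  where
  e′ : Fin (suc _) → Fin (suc n)
  e′ zero    = zero
  e′ (suc i) = suc (e i)
  inj′ : Injective _≡_ _≡_ e′
  inj′ {zero}  {zero}  _  = ≡.refl
  inj′ {zero}  {suc j} ()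
  inj′ {suc i} {zero}  ()
  inj′ {suc i} {suc j} eq = ≡.cong suc (inj (suc-injective eq))
  sound′ : ∀ i → _
  sound′ zero    = p
  sound′ (suc i) = sound i
  complete′ : ∀ k → _ → _
  complete′ zero    _ = zero , ≡.refl
  complete′ (suc k) p′ with complete k p′
  ... | i , ≡.refl = suc i , ≡.refl

funToFin-cong : ∀ {k l} {f g : Fin k → Fin l} → (∀ i → f i ≡ g i) → funToFin f ≡ funToFin g
funToFin-cong {zero}  f≗g = ≡.refl
funToFin-cong {suc k} f≗g = ≡.cong₂ combine (f≗g zero) (funToFin-cong (f≗g ∘ suc))

-- Polynomial evaluation

-- The condition on `h` covers the positions past the end of the list, where `coeff` defaults to
-- zero on both sides.
coeff-map : ∀ {a ℓa b ℓb} (A : RawRing a ℓa) (B : CommutativeRing b ℓb) →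
            let module A = RawRing A; module B = CommutativeRing B in
            (h : A.Carrier → B.Carrier) → h A.0# B.≈ B.0# →
            ∀ p i → Polynomial.coeff B.rawRing (map h p) i B.≈ h (Polynomial.coeff A p i)
coeff-map A B h h0≈0 []      i       = CommutativeRing.sym B h0≈0
coeff-map A B h h0≈0 (a ∷ p) zero    = CommutativeRing.refl B
coeff-map A B h h0≈0 (a ∷ p) (suc i) = coeff-map A B h h0≈0 p i

module Evaluation {c ℓ} (K : CommutativeRing c ℓ) where
  open CommutativeRing K hiding (setoid; zero)
  open Polynomial rawRing using (Poly; coeff; eval)
  open import Algebra.Properties.Semiring.Exp semiring using (_^_)
  open import Algebra.Properties.Semiring.Sum semiring using (sum; sum-cong-≋; *-distribˡ-sum)
  open import Algebra.Properties.AbelianGroup +-abelianGroup using (⁻¹-∙-comm)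
  open import Algebra.Properties.Group +-group using (ε⁻¹≈ε)
  open import Algebra.Properties.Ring ring using (-‿distribʳ-*)
  open import Algebra.Properties.CommutativeSemigroup +-commutativeSemigroup using (interchange)
  open import Algebra.Properties.CommutativeSemigroup *-commutativeSemigroup using (x∙yz≈y∙xz)
  open import Relation.Binary.Reasoning.Setoid (CommutativeRing.setoid K)

  eval-congʳ : ∀ p {x y} → x ≈ y → eval p x ≈ eval p y
  eval-congʳ []      x≈y = refl
  eval-congʳ (a ∷ p) x≈y = +-congˡ (*-cong x≈y (eval-congʳ p x≈y))

  eval-zero : ∀ p x → (∀ i → coeff p i ≈ 0#) → eval p x ≈ 0#
  eval-zero []      x p≈0 = refl
  eval-zero (a ∷ p) x p≈0 = trans (+-cong (p≈0 0) (trans (*-congˡ (eval-zero p x (p≈0 ∘ suc))) (zeroʳ x))) (+-identityˡ _)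

  -- `N` bounds the degree rather than the length of the list, which may be shorter or may carry
  -- trailing zeros.
  eval≈sum : ∀ N p x → (∀ i → N ≤ i → coeff p i ≈ 0#) → eval p x ≈ sum {N} (λ i → coeff p (toℕ i) * x ^ toℕ i)
  eval≈sum zero    p  x p≈0 = eval-zero p x (λ i → p≈0 i z≤n)
  eval≈sum (suc N) p  x p≈0 = begin
    eval p x
      ≈⟨ uncons p ⟩
    coeff p 0 + x * eval (tail p) x
      ≈⟨ +-cong (sym (*-identityʳ _)) (*-congˡ (eval≈sum N (tail p) x tail≈0)) ⟩
    coeff p 0 * 1# + x * sum {N} (λ i → coeff (tail p) (toℕ i) * x ^ toℕ i)
      ≈⟨ +-congˡ (*-distribˡ-sum {N} x (λ i → coeff (tail p) (toℕ i) * x ^ toℕ i)) ⟩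
    coeff p 0 * 1# + sum {N} (λ i → x * (coeff (tail p) (toℕ i) * x ^ toℕ i))
      ≈⟨ +-congˡ (sum-cong-≋ {N} λ i → trans (x∙yz≈y∙xz _ _ _) (*-congʳ (coeff-tail p (toℕ i)))) ⟩
    coeff p 0 * 1# + sum {N} (λ i → coeff p (suc (toℕ i)) * (x * x ^ toℕ i)) ∎
    where
    tail : Poly → Poly
    tail []      = []
    tail (_ ∷ p) = p

    uncons : ∀ p → eval p x ≈ coeff p 0 + x * eval (tail p) x
    uncons []      = sym (trans (+-identityˡ _) (zeroʳ x))
    uncons (a ∷ p) = refl

    coeff-tail : ∀ p i → coeff (tail p) i ≈ coeff p (suc i)
    coeff-tail []      i = refl
    coeff-tail (a ∷ p) i = refl

    tail≈0 : ∀ i → N ≤ i → coeff (tail p) i ≈ 0#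
    tail≈0 i N≤i = trans (coeff-tail p i) (p≈0 (suc i) (s≤s N≤i))

  eval-map-cong : ∀ {a} {A : Set a} {g h : A → Carrier} → (∀ a → g a ≈ h a) → ∀ p x → eval (map g p) x ≈ eval (map h p) x
  eval-map-cong g≈h []      x = refl
  eval-map-cong g≈h (a ∷ p) x = +-cong (g≈h a) (*-congˡ (eval-map-cong g≈h p x))

  -- Multiplying by `a ∷ f` is scaling by `a` plus a shift, so the Horner recursion alone gives
  -- additivity and multiplicativity by induction on the list. Keeping `φ` abstract covers both
  -- plain evaluation and evaluation after mapping `h` over the coefficients.
  horner-isRingHomomorphism :
    ∀ {a ℓa} (A : RawRing a ℓa) {h : RawRing.Carrier A → Carrier} → IsRingHomomorphism A rawRing h →
    ∀ x (φ : Polynomial.Poly A → Carrier) → φ [] ≈ 0# → (∀ a p → φ (a ∷ p) ≈ h a + x * φ p) →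
    IsRingHomomorphism (Polynomial.polyRing A) rawRing φ
  horner-isRingHomomorphism A {h} isHom x φ φ-[] φ-∷ = record
    { isSemiringHomomorphism = record
      { isNearSemiringHomomorphism = record
        { +-isMonoidHomomorphism = record
          { isMagmaHomomorphism = record
            { isRelHomomorphism = record { cong = λ {f} {g} → φ-cong f g }
            ; homo = φ-+
            }
          ; ε-homo = φ-[]
          }
        ; *-homo = φ-*
        }
      ; 1#-homo = φ-1
      }
    ; -‿homo = φ-neg
    }
    where
    module A = RawRing A
    module AP = Polynomial A
    module h = IsRingHomomorphism isHom

    φ-0∷ : ∀ {a} p → a A.≈ A.0# → φ (a ∷ p) ≈ x * φ p
    φ-0∷ p a≈0 = trans (φ-∷ _ p) (trans (+-congʳ (trans (h.⟦⟧-cong a≈0) h.0#-homo)) (+-identityˡ _))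

    φ-zero : ∀ f → (∀ n → AP.coeff f n A.≈ A.0#) → φ f ≈ 0#
    φ-zero []      f≈0 = φ-[]
    φ-zero (a ∷ f) f≈0 = trans (φ-0∷ f (f≈0 0)) (trans (*-congˡ (φ-zero f (f≈0 ∘ suc))) (zeroʳ x))

    -- Equal polynomials can be lists of different lengths; the mixed cases show that a list of zero
    -- coefficients has value zero.
    φ-cong : ∀ f g → (∀ n → AP.coeff f n A.≈ AP.coeff g n) → φ f ≈ φ g
    φ-cong []      []      f≈g = refl
    φ-cong []      (b ∷ g) f≈g = begin
      φ []             ≈⟨ φ-[] ⟩
      0#               ≈⟨ zeroʳ x ⟨
      x * 0#           ≈⟨ *-congˡ (trans (sym φ-[]) (φ-cong [] g (f≈g ∘ suc))) ⟩
      x * φ g          ≈⟨ +-identityˡ _ ⟨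
      0# + x * φ g     ≈⟨ +-congʳ (trans (sym h.0#-homo) (h.⟦⟧-cong (f≈g 0))) ⟩
      h b + x * φ g    ≈⟨ φ-∷ b g ⟨
      φ (b ∷ g)        ∎
    φ-cong (a ∷ f) []      f≈g = trans (φ-zero (a ∷ f) f≈g) (sym φ-[])
    φ-cong (a ∷ f) (b ∷ g) f≈g = begin
      φ (a ∷ f)        ≈⟨ φ-∷ a f ⟩
      h a + x * φ f    ≈⟨ +-cong (h.⟦⟧-cong (f≈g 0)) (*-congˡ (φ-cong f g (f≈g ∘ suc))) ⟩
      h b + x * φ g    ≈⟨ φ-∷ b g ⟨
      φ (b ∷ g)        ∎

    φ-1 : φ (A.1# ∷ []) ≈ 1#
    φ-1 = begin
      φ (A.1# ∷ [])      ≈⟨ φ-∷ _ _ ⟩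
      h A.1# + x * φ []  ≈⟨ +-cong h.1#-homo (trans (*-congˡ φ-[]) (zeroʳ x)) ⟩
      1# + 0#            ≈⟨ +-identityʳ 1# ⟩
      1#                 ∎

    φ-+ : ∀ f g → φ (AP.addᴾ f g) ≈ φ f + φ g
    φ-+ []      g       = sym (trans (+-congʳ φ-[]) (+-identityˡ _))
    φ-+ (a ∷ f) []      = sym (trans (+-congˡ φ-[]) (+-identityʳ _))
    φ-+ (a ∷ f) (b ∷ g) = begin
      φ (a A.+ b ∷ AP.addᴾ f g)              ≈⟨ φ-∷ _ _ ⟩
      h (a A.+ b) + x * φ (AP.addᴾ f g)      ≈⟨ +-cong (h.+-homo a b) (trans (*-congˡ (φ-+ f g)) (distribˡ x _ _)) ⟩
      (h a + h b) + (x * φ f + x * φ g)      ≈⟨ interchange _ _ _ _ ⟩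
      (h a + x * φ f) + (h b + x * φ g)      ≈⟨ +-cong (φ-∷ a f) (φ-∷ b g) ⟨
      φ (a ∷ f) + φ (b ∷ g)                  ∎

    φ-scale : ∀ a g → φ (map (a A.*_) g) ≈ h a * φ g
    φ-scale a []      = trans φ-[] (sym (trans (*-congˡ φ-[]) (zeroʳ _)))
    φ-scale a (b ∷ g) = begin
      φ (a A.* b ∷ map (a A.*_) g)           ≈⟨ φ-∷ _ _ ⟩
      h (a A.* b) + x * φ (map (a A.*_) g)   ≈⟨ +-cong (h.*-homo a b) (*-congˡ (φ-scale a g)) ⟩
      h a * h b + x * (h a * φ g)            ≈⟨ +-congˡ (x∙yz≈y∙xz _ _ _) ⟩
      h a * h b + h a * (x * φ g)            ≈⟨ distribˡ _ _ _ ⟨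
      h a * (h b + x * φ g)                  ≈⟨ *-congˡ (φ-∷ b g) ⟨
      h a * φ (b ∷ g)                        ∎

    φ-* : ∀ f g → φ (AP.mulᴾ f g) ≈ φ f * φ g
    φ-* []      g = trans φ-[] (sym (trans (*-congʳ φ-[]) (zeroˡ _)))
    φ-* (a ∷ f) g = begin
      φ (AP.addᴾ (map (a A.*_) g) (A.0# ∷ AP.mulᴾ f g))  ≈⟨ φ-+ (map (a A.*_) g) _ ⟩
      φ (map (a A.*_) g) + φ (A.0# ∷ AP.mulᴾ f g)        ≈⟨ +-cong (φ-scale a g) (φ-∷ _ _) ⟩
      h a * φ g + (h A.0# + x * φ (AP.mulᴾ f g))         ≈⟨ +-congˡ (+-cong h.0#-homo (*-congˡ (φ-* f g))) ⟩
      h a * φ g + (0# + x * (φ f * φ g))                 ≈⟨ +-congˡ (trans (+-identityˡ _) (sym (*-assoc _ _ _))) ⟩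
      h a * φ g + x * φ f * φ g                          ≈⟨ distribʳ _ _ _ ⟨
      (h a + x * φ f) * φ g                              ≈⟨ *-congʳ (φ-∷ a f) ⟨
      φ (a ∷ f) * φ g                                    ∎

    φ-neg : ∀ f → φ (map A.-_ f) ≈ - φ f
    φ-neg []      = trans φ-[] (sym (trans (-‿cong φ-[]) ε⁻¹≈ε))
    φ-neg (a ∷ f) = begin
      φ (A.- a ∷ map A.-_ f)           ≈⟨ φ-∷ _ _ ⟩
      h (A.- a) + x * φ (map A.-_ f)   ≈⟨ +-cong (h.-‿homo a) (*-congˡ (φ-neg f)) ⟩
      - h a + x * - φ f                ≈⟨ +-congˡ (-‿distribʳ-* x (φ f)) ⟨
      - h a + - (x * φ f)              ≈⟨ ⁻¹-∙-comm _ _ ⟩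
      - (h a + x * φ f)                ≈⟨ -‿cong (φ-∷ a f) ⟨
      - φ (a ∷ f)                      ∎

  eval-isRingHomomorphism : ∀ x → IsRingHomomorphism (Polynomial.polyRing rawRing) rawRing (λ p → eval p x)
  eval-isRingHomomorphism x =
    horner-isRingHomomorphism rawRing (isRingHomomorphism rawRing refl) x (λ p → eval p x) refl (λ _ _ → refl)

  eval-map-isRingHomomorphism :
    ∀ {a ℓa} (A : RawRing a ℓa) {h : RawRing.Carrier A → Carrier} → IsRingHomomorphism A rawRing h →
    ∀ x → IsRingHomomorphism (Polynomial.polyRing A) rawRing (λ p → eval (map h p) x)
  eval-map-isRingHomomorphism A {h} isHom x =
    horner-isRingHomomorphism A isHom x (λ p → eval (map h p) x) refl (λ _ _ → refl)

  module _ {a ℓa} (A : RawRing a ℓa) {h : RawRing.Carrier A → Carrier} (isHom : IsRingHomomorphism A rawRing h) where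
    open RawSemiringDefinitions (RawRing.rawSemiring A) using () renaming (_^_ to _^ᴬ_)
    open IsRingHomomorphism isHom

    ^-homo : ∀ a n → h (a ^ᴬ n) ≈ h a ^ n
    ^-homo a zero    = 1#-homo
    ^-homo a (suc n) = trans (*-homo a (a ^ᴬ n)) (*-congˡ (^-homo a n))

-- Finite fields: inverses, Fermat's little theorem, power sums

module FiniteFieldTheory
  {c ℓ₁ ℓ₂} (F : HeytingField c ℓ₁ ℓ₂) {m : ℕ}
  (enumeration : Inverse (fieldSetoid F) (setoid (Fin (suc (suc m))))) where

  K : CommutativeRing c ℓ₁
  K = HeytingCommutativeRing.commutativeRing (HeytingField.heytingCommutativeRing F)

  open CommutativeRing K hiding (setoid; zero)
  open FiniteField F enumeration hiding (Carrier; _≈_; 0#; 1#)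
  open LinearAlgebra 𝔽 using (linearCombination; InSpan; LinearlyIndependent)
  open Inverse enumeration using (to; from; to-cong; strictlyInverseˡ; strictlyInverseʳ)
  open import Algebra.Properties.Semiring.Exp semiring using (_^_; ^-congˡ; ^-homo-*)
  open import Algebra.Properties.CommutativeSemiring.Exp commutativeSemiring using (^-distrib-*)
  open import Algebra.Properties.Semiring.Sum semiring
    using (sum; sum-cong-≋; *-distribˡ-sum; *-distribʳ-sum; sum-init-last)
  open import Algebra.Properties.CommutativeMonoid.Sum +-commutativeMonoid using (∑-comm; ∑-distrib-+)
  open import Algebra.Properties.CommutativeSemigroup *-commutativeSemigroup using (x∙yz≈y∙xz)
  open import Algebra.Properties.Group +-group using (x∙y⁻¹≈ε⇒x≈y; ∙-cancelˡ; ∙-cancelʳ)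
  open Evaluation K
  open import Relation.Binary.Reasoning.Setoid (CommutativeRing.setoid K)
  import Algebra.Properties.CommutativeMonoid.Sum *-commutativeMonoid as Π

  -- With `q` in this form, `q ∸ 1` and `q ∸ 2` compute to `n` and `m`, and the modulus `n` is
  -- visibly nonzero.
  q n : ℕ
  q = suc (suc m)
  n = suc m

  to-injective : ∀ {x y} → to x ≡ to y → x ≈ y
  to-injective {x} {y} eq = trans (sym (strictlyInverseʳ x)) (trans (reflexive (≡.cong from eq)) (strictlyInverseʳ y))

  from-injective : Injective _≡_ _≈_ from
  from-injective {i} {j} eq = ≡.trans (≡.sym (strictlyInverseˡ i)) (≡.trans (to-cong eq) (strictlyInverseˡ j))

  -- The field axioms invert only elements apart from 0. Searching the finitely many candidates
  -- decides invertibility, and if none works then `x` is not apart from 0, so tightness makes it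
  -- equal to 0.
  inverse : ∀ {x} → ¬ x ≈ 0# → ∃[ y ] x * y ≈ 1#
  inverse {x} x≉0 with any? (λ k → x * from k ≟ 1#)
  ... | yes (k , eq) = from k , eq
  ... | no noInverse = contradiction (proj₁ (HeytingField.tight F x 0#) notApart) x≉0
    where
    notApart : ¬ HeytingField._#_ F x 0#
    notApart x#0 with HeytingField.#⇒invertible F x#0
    ... | y , _ , eq = noInverse (to y , (begin
      x * from (to y)   ≈⟨ *-cong (sym (trans (+-congˡ ε⁻¹≈ε) (+-identityʳ x))) (strictlyInverseʳ y) ⟩
      (x - 0#) * y      ≈⟨ eq ⟩
      1#                ∎))
      where open import Algebra.Properties.Group +-group using (ε⁻¹≈ε)

  -- If 1 were 0, all elements would coincide, but the enumeration has at least two.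
  1≉0 : ¬ 1# ≈ 0#
  1≉0 1≈0 = contradiction (to-cong-all (from zero) (from (suc zero))) λ eq → contradiction (from-injective eq) λ ()
    where
    to-cong-all : ∀ x y → x ≈ y
    to-cong-all x y = begin
      x       ≈⟨ *-identityˡ x ⟨
      1# * x  ≈⟨ *-congʳ 1≈0 ⟩
      0# * x  ≈⟨ trans (zeroˡ x) (sym (zeroˡ y)) ⟩
      0# * y  ≈⟨ *-congʳ 1≈0 ⟨
      1# * y  ≈⟨ *-identityˡ y ⟩
      y       ∎

  *-cancelˡ-≉0 : ∀ {x y z} → ¬ x ≈ 0# → x * y ≈ x * z → y ≈ z
  *-cancelˡ-≉0 {x} {y} {z} x≉0 eq with inverse x≉0
  ... | x⁻¹ , inv = begin
    y               ≈⟨ undo y ⟨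
    x⁻¹ * (x * y)   ≈⟨ *-congˡ eq ⟩
    x⁻¹ * (x * z)   ≈⟨ undo z ⟩
    z               ∎
    where
    undo : ∀ w → x⁻¹ * (x * w) ≈ w
    undo w = trans (sym (*-assoc _ _ _)) (trans (*-congʳ (trans (*-comm _ _) inv)) (*-identityˡ w))

  *-≉0 : ∀ {x y} → ¬ x ≈ 0# → ¬ y ≈ 0# → ¬ x * y ≈ 0#
  *-≉0 {x} x≉0 y≉0 xy≈0 = y≉0 (*-cancelˡ-≉0 x≉0 (trans xy≈0 (sym (zeroʳ x))))

  -- Skipping the index of 0 with `punchIn` matches `sum-remove`, so splitting a sum over the whole
  -- field at 0 leaves a sum over this family.
  nonzero : Fin n → Carrier
  nonzero k = from (punchIn (to 0#) k)

  nonzero≉0 : ∀ k → ¬ nonzero k ≈ 0#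
  nonzero≉0 k eq = punchInᵢ≢i (to 0#) k (≡.trans (≡.sym (strictlyInverseˡ _)) (to-cong eq))

  nonzero-injective : Injective _≡_ _≈_ nonzero
  nonzero-injective = punchIn-injective (to 0#) _ _ ∘ from-injective

  nonzero-surjective : ∀ {x} → ¬ x ≈ 0# → ∃[ k ] nonzero k ≈ x
  nonzero-surjective {x} x≉0 = punchOut 0≢x , trans (reflexive (≡.cong from (punchIn-punchOut 0≢x))) (strictlyInverseʳ x)
    where
    0≢x : to 0# ≢ to x
    0≢x eq = x≉0 (sym (to-injective eq))

  -- Multiplication by b permutes the nonzero elements, so their product absorbs bⁿ.
  b^n≈1 : ∀ {b} → ¬ b ≈ 0# → b ^ n ≈ 1#
  b^n≈1 {b} b≉0 = *-cancelˡ-≉0 (product≉0 nonzero nonzero≉0) (begin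
    Π.sum nonzero * b ^ n                        ≈⟨ *-comm _ _ ⟩
    b ^ n * Π.sum nonzero                        ≈⟨ *-congʳ (Π.sum-replicate n) ⟨
    Π.sum {n} (λ _ → b) * Π.sum nonzero          ≈⟨ Π.∑-distrib-+ {n} (λ _ → b) nonzero ⟨
    Π.sum (λ k → b * nonzero k)                  ≈⟨ Π.sum-cong-≋ (λ k → proj₂ (image k)) ⟨
    Π.sum (nonzero ∘ σ)                          ≈⟨ sum-reindex *-commutativeMonoid σ σ-injective nonzero
                                                      (λ k missed → contradiction (proj₂ (σ-surjective k)) (missed _)) ⟨
    Π.sum nonzero                                ≈⟨ *-identityʳ _ ⟨
    Π.sum nonzero * 1#                           ∎)
    where
    product≉0 : ∀ {k} (t : Vector Carrier k) → (∀ i → ¬ t i ≈ 0#) → ¬ Π.sum t ≈ 0#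
    product≉0 {zero}  t t≉0 = 1≉0
    product≉0 {suc k} t t≉0 = *-≉0 (t≉0 zero) (product≉0 (t ∘ suc) (t≉0 ∘ suc))

    image : ∀ k → ∃[ l ] nonzero l ≈ b * nonzero k
    image k = nonzero-surjective (*-≉0 b≉0 (nonzero≉0 k))

    σ : Fin n → Fin n
    σ = proj₁ ∘ image

    σ-injective : Injective _≡_ _≡_ σ
    σ-injective {k} {l} eq = nonzero-injective (*-cancelˡ-≉0 b≉0
      (trans (sym (proj₂ (image k))) (trans (reflexive (≡.cong nonzero eq)) (proj₂ (image l)))))

    σ-surjective = injective⇒surjective σ σ-injective

  b^q≈b : ∀ b → b ^ q ≈ b
  b^q≈b b with b ≟ 0#
  ... | yes b≈0 = trans (*-congʳ b≈0) (trans (zeroˡ _) (sym b≈0))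
  ... | no b≉0  = trans (*-congˡ (b^n≈1 b≉0)) (*-identityʳ b)

  -- Translation by 1 permutes the field, so the sum of its elements absorbs q · 1.
  sum-ones-q≈0 : sum {q} (λ _ → 1#) ≈ 0#
  sum-ones-q≈0 = ∙-cancelʳ (sum from) _ _ (begin
    sum {q} (λ _ → 1#) + sum from    ≈⟨ ∑-distrib-+ {q} (λ _ → 1#) from ⟨
    sum (λ k → 1# + from k)          ≈⟨ sum-cong-≋ (λ k → strictlyInverseʳ (1# + from k)) ⟨
    sum (from ∘ σ)                   ≈⟨ sum-reindex +-commutativeMonoid σ σ-injective from
                                          (λ k missed → contradiction (proj₂ (σ-surjective k)) (missed _)) ⟨
    sum from                         ≈⟨ +-identityˡ _ ⟨
    0# + sum from                    ∎)
    where
    σ : Fin q → Fin q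
    σ k = to (1# + from k)

    σ-injective : Injective _≡_ _≡_ σ
    σ-injective eq = from-injective (∙-cancelˡ 1# _ _ (to-injective eq))

    σ-surjective = injective⇒surjective σ σ-injective

  -- The familiar (y - 1)s = y^N - 1 with the negative terms moved across, which lets the induction
  -- avoid subtraction.
  geometric-sum : ∀ N y → y * sum {N} (λ i → y ^ toℕ i) + 1# ≈ sum {N} (λ i → y ^ toℕ i) + y ^ N
  geometric-sum zero    y = +-congʳ (zeroʳ y)
  geometric-sum (suc N) y = begin
    y * (1# + shifted) + 1#                     ≈⟨ +-congʳ (*-congˡ (trans (+-comm _ _) (+-congʳ (sym (*-distribˡ-sum {N} y _))))) ⟩
    y * (y * powers + 1#) + 1#                  ≈⟨ +-congʳ (*-congˡ (geometric-sum N y)) ⟩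
    y * (powers + y ^ N) + 1#                   ≈⟨ +-congʳ (distribˡ _ _ _) ⟩
    (y * powers + y ^ suc N) + 1#               ≈⟨ trans (+-comm _ _) (sym (+-assoc _ _ _)) ⟩
    1# + y * powers + y ^ suc N                 ≈⟨ +-congʳ (+-congˡ (*-distribˡ-sum {N} y _)) ⟩
    1# + shifted + y ^ suc N                    ∎
    where
    powers = sum {N} (λ i → y ^ toℕ i)
    shifted = sum {N} (λ i → y * y ^ toℕ i)

  -- Since y^n = 1, the geometric sum s satisfies y s = s; a nonzero s could be cancelled, giving y
  -- = 1.
  sum-powers≈0 : ∀ {y} → ¬ y ≈ 0# → ¬ y ≈ 1# → sum {n} (λ i → y ^ toℕ i) ≈ 0#
  sum-powers≈0 {y} y≉0 y≉1 with sum {n} (λ i → y ^ toℕ i) ≟ 0#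
  ... | yes s≈0 = s≈0
  ... | no s≉0 = contradiction (*-cancelˡ-≉0 s≉0 (trans (*-comm _ _) (trans ys≈s (sym (*-identityʳ _))))) y≉1
    where
    ys≈s : y * sum {n} (λ i → y ^ toℕ i) ≈ sum {n} (λ i → y ^ toℕ i)
    ys≈s = ∙-cancelʳ 1# _ _ (trans (geometric-sum n y) (+-congˡ (b^n≈1 y≉0)))

  -- One more summand makes it the sum of `q` ones, which is 0; so this sum is -1.
  sum-ones-n≉0 : ¬ sum {n} (λ _ → 1#) ≈ 0#
  sum-ones-n≉0 eq = 1≉0 (trans (sym (trans (+-congˡ eq) (+-identityʳ 1#))) sum-ones-q≈0)

  1^k≈1 : ∀ k → 1# ^ k ≈ 1#
  1^k≈1 zero    = refl
  1^k≈1 (suc k) = trans (*-identityˡ _) (1^k≈1 k)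

  -- Pairing the relation with the powers of y_l⁻¹ isolates the coefficient of y_l.
  powers-independent : ∀ {p} (y : Fin p → Carrier) → Injective _≡_ _≈_ y → (∀ k → ¬ y k ≈ 0#) →
                       LinearlyIndependent {m = n} (λ k i → y k ^ toℕ i)
  powers-independent {p} y y-inj y≉0 a relation l with inverse (y≉0 l)
  ... | z , yz≈1 = *-cancelˡ-≉0 sum-ones-n≉0 (begin
    sum {n} (λ _ → 1#) * a l
      ≈⟨ *-comm _ _ ⟩
    a l * sum {n} (λ _ → 1#)
      -- The ratio `z * y l` is 1, so `geo l` is a sum of `n` ones. Every other ratio `z * y k` is
      -- neither 0 nor 1, so its `geo k` vanishes.
      ≈⟨ *-congˡ (sum-cong-≋ {n} (λ i → trans (^-congˡ (toℕ i) {z * y l} (trans (*-comm z (y l)) yz≈1)) (1^k≈1 (toℕ i)))) ⟨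
    a l * geo l
      ≈⟨ sum-supported +-commutativeMonoid (λ k → a k * geo k) l (λ k k≢l → trans (*-congˡ (geo≈0 k≢l)) (zeroʳ _)) ⟨
    sum (λ k → a k * geo k)
      ≈⟨ sum-cong-≋ (λ k → *-distribˡ-sum {n} (a k) (λ i → (z * y k) ^ toℕ i)) ⟩
    sum (λ k → sum {n} (λ i → a k * (z * y k) ^ toℕ i))
      ≈⟨ ∑-comm {p} {n} (λ k i → a k * (z * y k) ^ toℕ i) ⟩
    sum {n} (λ i → sum (λ k → a k * (z * y k) ^ toℕ i))
      ≈⟨ sum-cong-≋ {n} (λ i → sum-cong-≋ (λ k → trans (*-congˡ {a k} (^-distrib-* z (y k) (toℕ i))) (x∙yz≈y∙xz _ _ _))) ⟩
    sum {n} (λ i → sum (λ k → z ^ toℕ i * (a k * y k ^ toℕ i)))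
      ≈⟨ sum-cong-≋ {n} (λ i → *-distribˡ-sum {p} (z ^ toℕ i) (λ k → a k * y k ^ toℕ i)) ⟨
    sum {n} (λ i → z ^ toℕ i * sum (λ k → a k * y k ^ toℕ i))
      ≈⟨ sum-zero +-commutativeMonoid {n} _ (λ i → trans (*-congˡ {z ^ toℕ i} (relation i)) (zeroʳ _)) ⟩
    0#
      ≈⟨ zeroʳ _ ⟨
    sum {n} (λ _ → 1#) * 0# ∎)
    where
    geo : Fin p → Carrier
    geo k = sum {n} (λ i → (z * y k) ^ toℕ i)

    z≉0 : ¬ z ≈ 0#
    z≉0 z≈0 = 1≉0 (trans (sym yz≈1) (trans (*-congˡ z≈0) (zeroʳ _)))

    geo≈0 : ∀ {k} → k ≢ l → geo k ≈ 0#
    geo≈0 {k} k≢l = sum-powers≈0 (*-≉0 z≉0 (y≉0 k))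
      (λ zy≈1 → k≢l (y-inj (*-cancelˡ-≉0 z≉0 (trans zy≈1 (trans (sym yz≈1) (*-comm _ _))))))

  -- Linear independence over a finite field

  independent⇒injective : ∀ {k d} (v : Vector (Vector Carrier d) k) → LinearlyIndependent v → ∀ a b →
                          (∀ i → linearCombination a v i ≈ linearCombination b v i) → ∀ l → a l ≈ b l
  independent⇒injective {k} v indep a b eq l = x∙y⁻¹≈ε⇒x≈y _ _ (indep (λ l → a l - b l) difference l)
    where
    difference : ∀ i → sum (λ l → (a l - b l) * v l i) ≈ 0#
    difference i = ∙-cancelʳ (linearCombination b v i) _ _ (begin
      sum (λ l → (a l - b l) * v l i) + sum (λ l → b l * v l i)   ≈⟨ ∑-distrib-+ {k} _ _ ⟨
      sum (λ l → (a l - b l) * v l i + b l * v l i)               ≈⟨ sum-cong-≋ {k} (λ l → trans (sym (distribʳ _ _ _)) (*-congʳ (x-y+y≈x _ _))) ⟩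
      sum (λ l → a l * v l i)                                     ≈⟨ eq i ⟩
      sum (λ l → b l * v l i)                                     ≈⟨ +-identityˡ _ ⟨
      0# + sum (λ l → b l * v l i)                                ∎)
      where
      x-y+y≈x : ∀ x y → (x - y) + y ≈ x
      x-y+y≈x x y = trans (+-assoc _ _ _) (trans (+-congˡ (-‿inverseˡ y)) (+-identityʳ x))

  -- The coordinates become base-`q` digits, so that the pigeonhole principle on `Fin` applies to
  -- linear maps.
  decode : ∀ k → Fin (q ℕ.^ k) → Vector Carrier k
  decode k x = from ∘ finToFun x

  encode : ∀ {k} → Vector Carrier k → Fin (q ℕ.^ k)
  encode a = funToFin (to ∘ a)

  decode-encode : ∀ {k} (a : Vector Carrier k) i → decode _ (encode a) i ≈ a i
  decode-encode a i = trans (reflexive (≡.cong from (finToFun-funToFin (to ∘ a) i))) (strictlyInverseʳ (a i))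

  encode-injective : ∀ {k} (a b : Vector Carrier k) → encode a ≡ encode b → ∀ i → a i ≈ b i
  encode-injective {k} a b eq i =
    trans (sym (decode-encode a i)) (trans (reflexive (≡.cong (λ x → decode k x i) eq)) (decode-encode b i))

  decode-injective : ∀ k (x y : Fin (q ℕ.^ k)) → (∀ i → decode k x i ≈ decode k y i) → x ≡ y
  decode-injective k x y eq = ≡.trans (≡.sym (funToFin-finToFin {k} x))
    (≡.trans (funToFin-cong {k} {q} (λ i → from-injective (eq i))) (funToFin-finToFin {k} y))

  -- Associativity of the matrix product a A w. It serves both to compose spans and to apply a
  -- matrix to a linear combination.
  linearCombination-trans : ∀ {k l d} (a : Vector Carrier k) (A : Fin k → Vector Carrier l) (w : Vector (Vector Carrier d) l) i →
    sum (λ s → a s * linearCombination (A s) w i) ≈ linearCombination (λ t → sum (λ s → a s * A s t)) w i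
  linearCombination-trans {k} {l} a A w i = begin
    sum (λ s → a s * sum (λ t → A s t * w t i))     ≈⟨ sum-cong-≋ {k} (λ s → *-distribˡ-sum {l} (a s) _) ⟩
    sum (λ s → sum (λ t → a s * (A s t * w t i)))   ≈⟨ ∑-comm {k} {l} (λ s t → a s * (A s t * w t i)) ⟩
    sum (λ t → sum (λ s → a s * (A s t * w t i)))   ≈⟨ sum-cong-≋ {l} (λ t → trans (sum-cong-≋ {k} (λ s → sym (*-assoc _ _ _)))
                                                         (sym (*-distribʳ-sum {k} (w t i) _))) ⟩
    sum (λ t → sum (λ s → a s * A s t) * w t i)     ∎

  -- Expressing combinations of v in terms of w embeds F^k into F^l.
  independent⇒≤ : ∀ {k l d} (v : Vector (Vector Carrier d) k) (w : Vector (Vector Carrier d) l) →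
                  LinearlyIndependent v → (∀ s → InSpan w (v s)) → k ≤ l
  independent⇒≤ {k} {l} v w indep spanned = ℕ.≮⇒≥ (λ l<k →
    -- As `q` is at least 2, `l < k` would make the target of `f` smaller than its source.
    ℕ.<⇒≱ (ℕ.^-monoʳ-< q (s≤s (s≤s z≤n)) l<k) (injective⇒≤ f-injective))
    where
    A : Fin k → Vector Carrier l
    A s = proj₁ (spanned s)

    coordinates : Vector Carrier k → Vector Carrier l
    coordinates a t = sum (λ s → a s * A s t)

    combination : ∀ a i → linearCombination a v i ≈ linearCombination (coordinates a) w i
    combination a i = trans (sum-cong-≋ {k} (λ s → *-congˡ (sym (proj₂ (spanned s) i)))) (linearCombination-trans a A w i)

    f : Fin (q ℕ.^ k) → Fin (q ℕ.^ l)
    f = encode ∘ coordinates ∘ decode k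

    f-injective : Injective _≡_ _≡_ f
    f-injective {x} {y} eq = decode-injective k x y (independent⇒injective v indep _ _ (λ i → begin
      linearCombination (decode k x) v i                 ≈⟨ combination (decode k x) i ⟩
      linearCombination (coordinates (decode k x)) w i   ≈⟨ sum-cong-≋ {l} (λ t → *-congʳ (encode-injective (coordinates (decode k x)) (coordinates (decode k y)) eq t)) ⟩
      linearCombination (coordinates (decode k y)) w i   ≈⟨ combination (decode k y) i ⟨
      linearCombination (decode k y) v i                 ∎))

  -- Independence makes the map from coefficients to combinations injective on F^d, and an injective
  -- self-map of a finite set is surjective.
  independent⇒spanning : ∀ {d} (v : Vector (Vector Carrier d) d) → LinearlyIndependent v → ∀ w → InSpan v w
  independent⇒spanning {d} v indep w with injective⇒surjective f f-injective (encode w)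
    where
    f : Fin (q ℕ.^ d) → Fin (q ℕ.^ d)
    f x = encode (linearCombination (decode d x) v)

    f-injective : Injective _≡_ _≡_ f
    f-injective {x} {y} eq = decode-injective d x y (independent⇒injective v indep _ _
      (encode-injective (linearCombination (decode d x) v) (linearCombination (decode d y) v) eq))
  ... | x , fx≡w = decode d x , encode-injective _ w fx≡w

  InSpan-trans : ∀ {k l d} (u : Vector (Vector Carrier d) k) (w : Vector (Vector Carrier d) l) {x : Vector Carrier d} →
                 InSpan u x → (∀ s → InSpan w (u s)) → InSpan w x
  InSpan-trans {k} u w (a , eq) u∈w = (λ t → sum (λ s → a s * proj₁ (u∈w s) t)) , λ i → begin
    linearCombination (λ t → sum (λ s → a s * proj₁ (u∈w s) t)) w i
      ≈⟨ linearCombination-trans a (λ s → proj₁ (u∈w s)) w i ⟨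
    sum (λ s → a s * linearCombination (proj₁ (u∈w s)) w i)
      ≈⟨ sum-cong-≋ {k} (λ s → *-congˡ (proj₂ (u∈w s) i)) ⟩
    linearCombination a u i
      ≈⟨ eq i ⟩
    _ ∎

  -- Rank of left circulant matrices

  -- Sliding the window by one step drops `h i` and gains `h (i + n)`, which are equal.
  sum-periodic : ∀ (h : ℕ → Carrier) → (∀ k → h (k ℕ.+ n) ≈ h k) → ∀ i →
                 sum {n} (λ j → h (i ℕ.+ toℕ j)) ≈ sum {n} (λ j → h (toℕ j))
  sum-periodic h periodic zero    = refl
  sum-periodic h periodic (suc i) = trans (∙-cancelˡ (h i) _ _ (begin
    h i + sum {n} (λ j → h (suc i ℕ.+ toℕ j))
      ≈⟨ +-cong (reflexive (≡.cong h (≡.sym (ℕ.+-identityʳ i))))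
           (sum-cong-≋ {n} (λ j → reflexive (≡.cong h (≡.sym (ℕ.+-suc i (toℕ j)))))) ⟩
    sum {suc n} (λ j → h (i ℕ.+ toℕ j))
      ≈⟨ sum-init-last {n} (λ j → h (i ℕ.+ toℕ j)) ⟩
    sum {n} (λ j → h (i ℕ.+ toℕ (inject₁ j))) + h (i ℕ.+ toℕ (fromℕ n))
      ≈⟨ +-cong (sum-cong-≋ {n} (λ j → reflexive (≡.cong (λ k → h (i ℕ.+ k)) (toℕ-inject₁ j))))
           (trans (reflexive (≡.cong (λ k → h (i ℕ.+ k)) (toℕ-fromℕ n))) (periodic i)) ⟩
    sum {n} (λ j → h (i ℕ.+ toℕ j)) + h i
      ≈⟨ +-comm _ _ ⟩
    h i + sum {n} (λ j → h (i ℕ.+ toℕ j)) ∎))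
    (sum-periodic h periodic i)

  -- The left circulant matrix reads only the coefficients below `n`, so this truncated evaluation
  -- is what it computes on power vectors.
  value : P₁.Poly → Carrier → Carrier
  value f x = sum {n} (λ i → P₁.coeff f (toℕ i) * x ^ toℕ i)

  -- Writing x^j as x^(i+j) y^i turns row `i` into a window, starting at `i`, of the sequence c_(k
  -- mod n) x^k. As x^n = 1 this sequence has period `n`, so every window sums to f(x).
  leftCirculant-powers : ∀ f {x y} → x * y ≈ 1# → ∀ i →
    sum {n} (λ j → leftCirculant f i j * x ^ toℕ j) ≈ value f x * y ^ toℕ i
  leftCirculant-powers f {x} {y} xy≈1 i = begin
    sum {n} (λ j → leftCirculant f i j * x ^ toℕ j)
      ≈⟨ sum-cong-≋ {n} shift ⟩
    sum {n} (λ j → h (toℕ i ℕ.+ toℕ j) * y ^ toℕ i)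
      ≈⟨ *-distribʳ-sum {n} (y ^ toℕ i) (λ j → h (toℕ i ℕ.+ toℕ j)) ⟨
    sum {n} (λ j → h (toℕ i ℕ.+ toℕ j)) * y ^ toℕ i
      ≈⟨ *-congʳ (sum-periodic h periodic (toℕ i)) ⟩
    sum {n} (λ j → h (toℕ j)) * y ^ toℕ i
      ≈⟨ *-congʳ (sum-cong-≋ {n} (λ j → *-congʳ {x ^ toℕ j} (reflexive (≡.cong (P₁.coeff f) (m<n⇒m%n≡m (toℕ<n j)))))) ⟩
    value f x * y ^ toℕ i ∎
    where
    h : ℕ → Carrier
    h k = P₁.coeff f (k % n) * x ^ k

    x≉0 : ¬ x ≈ 0#
    x≉0 x≈0 = 1≉0 (trans (sym xy≈1) (trans (*-congʳ x≈0) (zeroˡ y)))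

    periodic : ∀ k → h (k ℕ.+ n) ≈ h k
    periodic k = *-cong (reflexive (≡.cong (P₁.coeff f) ([m+n]%n≡m%n k n)))
      (trans (^-homo-* x k n) (trans (*-congˡ (b^n≈1 x≉0)) (*-identityʳ _)))

    shift : ∀ j → leftCirculant f i j * x ^ toℕ j ≈ h (toℕ i ℕ.+ toℕ j) * y ^ toℕ i
    shift j = begin
      c′ * x ^ toℕ j                             ≈⟨ *-congˡ (*-identityˡ _) ⟨
      c′ * (1# * x ^ toℕ j)                      ≈⟨ *-congˡ (*-congʳ xⁱyⁱ≈1) ⟨
      c′ * (x ^ toℕ i * y ^ toℕ i * x ^ toℕ j)   ≈⟨ *-congˡ (trans (*-assoc _ _ _) (trans (*-congˡ (*-comm _ _)) (sym (*-assoc _ _ _)))) ⟩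
      c′ * (x ^ toℕ i * x ^ toℕ j * y ^ toℕ i)   ≈⟨ *-congˡ (*-congʳ (^-homo-* x (toℕ i) (toℕ j))) ⟨
      c′ * (x ^ (toℕ i ℕ.+ toℕ j) * y ^ toℕ i)   ≈⟨ *-assoc _ _ _ ⟨
      h (toℕ i ℕ.+ toℕ j) * y ^ toℕ i            ∎
      where
      c′ = leftCirculant f i j
      xⁱyⁱ≈1 : x ^ toℕ i * y ^ toℕ i ≈ 1#
      xⁱyⁱ≈1 = trans (sym (^-distrib-* x y (toℕ i))) (trans (^-congˡ (toℕ i) xy≈1) (1^k≈1 (toℕ i)))

  reciprocal : Fin n → Carrier
  reciprocal k = proj₁ (inverse (nonzero≉0 k))

  nonzero*reciprocal : ∀ k → nonzero k * reciprocal k ≈ 1#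
  nonzero*reciprocal k = proj₂ (inverse (nonzero≉0 k))

  reciprocal≉0 : ∀ k → ¬ reciprocal k ≈ 0#
  reciprocal≉0 k y≈0 = 1≉0 (trans (sym (nonzero*reciprocal k)) (trans (*-congˡ y≈0) (zeroʳ _)))

  reciprocal-injective : Injective _≡_ _≈_ reciprocal
  reciprocal-injective {k} {l} eq = nonzero-injective (*-cancelˡ-≉0 (reciprocal≉0 k)
    (trans (*-comm _ _) (trans (nonzero*reciprocal k) (trans (sym (nonzero*reciprocal l)) (trans (*-comm _ _) (*-congʳ (sym eq)))))))

  standardBasis : ∀ {d} → Vector (Vector Carrier d) d
  standardBasis j l = if does (j ≟ᶠ l) then 1# else 0#

  standardBasis-on : ∀ {d} (j : Fin d) → standardBasis j j ≈ 1#
  standardBasis-on j with j ≟ᶠ j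
  ... | yes _  = refl
  ... | no j≢j = contradiction ≡.refl j≢j

  standardBasis-off : ∀ {d} {j l : Fin d} → l ≢ j → standardBasis j l ≈ 0#
  standardBasis-off {j = j} {l} l≢j with j ≟ᶠ l
  ... | yes j≡l = contradiction (≡.sym j≡l) l≢j
  ... | no _    = refl

  columns : ∀ {d e} → Matrix d e → Vector (Vector Carrier d) e
  columns M j i = M i j

  -- The standard basis vector e_j is a combination of the power vectors of the nonzero elements;
  -- the matrix is then applied to both sides.
  column-expansion : ∀ f j → ∃[ a ] ∀ i →
    leftCirculant f i j ≈ sum {n} (λ k → a k * value f (nonzero k) * reciprocal k ^ toℕ i)
  column-expansion f j = a , λ i → begin
    leftCirculant f i j
      ≈⟨ trans (*-congʳ (standardBasis-on j)) (*-identityˡ _) ⟨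
    standardBasis j j * leftCirculant f i j
      ≈⟨ sum-supported +-commutativeMonoid (λ l → standardBasis j l * leftCirculant f i l) j
           (λ l l≢j → trans (*-congʳ (standardBasis-off l≢j)) (zeroˡ _)) ⟨
    sum {n} (λ l → standardBasis j l * leftCirculant f i l)
      ≈⟨ sum-cong-≋ {n} (λ l → *-congʳ {leftCirculant f i l} (sym (proj₂ expansion l))) ⟩
    sum {n} (λ l → linearCombination a powers l * leftCirculant f i l)
      ≈⟨ linearCombination-trans a powers (columns (leftCirculant f)) i ⟨
    sum {n} (λ k → a k * sum {n} (λ l → nonzero k ^ toℕ l * leftCirculant f i l))
      ≈⟨ sum-cong-≋ {n} (λ k → *-congˡ {a k} (image k i)) ⟩
    sum {n} (λ k → a k * (value f (nonzero k) * reciprocal k ^ toℕ i))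
      ≈⟨ sum-cong-≋ {n} (λ k → sym (*-assoc (a k) (value f (nonzero k)) (reciprocal k ^ toℕ i))) ⟩
    sum {n} (λ k → a k * value f (nonzero k) * reciprocal k ^ toℕ i) ∎
    where
    powers : Vector (Vector Carrier n) n
    powers k i = nonzero k ^ toℕ i

    -- There are as many nonzero elements as dimensions, so independence of their power vectors
    -- makes them span.
    expansion : InSpan powers (standardBasis j)
    expansion = independent⇒spanning powers
      (powers-independent nonzero nonzero-injective nonzero≉0) (standardBasis j)

    a : Vector Carrier n
    a = proj₁ expansion

    image : ∀ k i → sum {n} (λ l → nonzero k ^ toℕ l * leftCirculant f i l) ≈ value f (nonzero k) * reciprocal k ^ toℕ i
    image k i = trans
      (sum-cong-≋ {n} (λ l → *-comm (nonzero k ^ toℕ l) (leftCirculant f i l)))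
      (leftCirculant-powers f (nonzero*reciprocal k) i)

  -- The matrix sends the power vector of β to f(β) times the vector in question; scaling by the
  -- inverse `d` of f(β) gives the coefficients.
  reciprocalPowers∈columns : ∀ f k → ¬ value f (nonzero k) ≈ 0# →
                             InSpan (columns (leftCirculant f)) (λ i → reciprocal k ^ toℕ i)
  reciprocalPowers∈columns f k D≉0 = (λ j → d * nonzero k ^ toℕ j) , λ i → begin
    sum {n} (λ j → d * nonzero k ^ toℕ j * leftCirculant f i j)
      ≈⟨ sum-cong-≋ {n} (λ j → trans (*-assoc d (nonzero k ^ toℕ j) _) (*-congˡ (*-comm (nonzero k ^ toℕ j) (leftCirculant f i j)))) ⟩
    sum {n} (λ j → d * (leftCirculant f i j * nonzero k ^ toℕ j))
      ≈⟨ *-distribˡ-sum {n} d (λ j → leftCirculant f i j * nonzero k ^ toℕ j) ⟨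
    d * sum {n} (λ j → leftCirculant f i j * nonzero k ^ toℕ j)
      ≈⟨ *-congˡ (leftCirculant-powers f (nonzero*reciprocal k) i) ⟩
    d * (value f (nonzero k) * reciprocal k ^ toℕ i)
      ≈⟨ trans (sym (*-assoc _ _ _)) (*-congʳ (trans (*-comm _ _) (proj₂ (inverse D≉0)))) ⟩
    1# * reciprocal k ^ toℕ i
      ≈⟨ *-identityˡ _ ⟩
    reciprocal k ^ toℕ i ∎
    where
    d : Carrier
    d = proj₁ (inverse D≉0)

  -- The given basis `v` and the reciprocal power vectors `w` at the non-roots are independent and
  -- span each other, so comparing sizes in both directions forces equality.
  rank-leftCirculant : ∀ f ρ → HasRank (leftCirculant f) ρ →
                       ρ ≡ ∑ℕ.sum {n} (λ k → 𝟙 (¬? (value f (nonzero k) ≟ 0#)))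
  rank-leftCirculant f ρ (v , v∈columns , columns∈v , v-independent) = ℕ.≤-antisym
    (independent⇒≤ v w v-independent (λ l → InSpan-trans (columns (leftCirculant f)) w (v∈columns l) columns∈w))
    (independent⇒≤ w v w-independent (λ s → InSpan-trans (columns (leftCirculant f)) v (w∈columns s) columns∈v))
    where
    nonroot? : ∀ k → Dec (¬ value f (nonzero k) ≈ 0#)
    nonroot? k = ¬? (value f (nonzero k) ≟ 0#)

    σ : ℕ
    σ = ∑ℕ.sum {n} (λ k → 𝟙 (nonroot? k))

    e : Fin σ → Fin n
    e = proj₁ (select nonroot?)

    e-injective : Injective _≡_ _≡_ e
    e-injective = proj₁ (proj₂ (select nonroot?))

    w : Vector (Vector Carrier n) σ
    w s i = reciprocal (e s) ^ toℕ i

    w-independent : LinearlyIndependent w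
    w-independent = powers-independent (reciprocal ∘ e) (e-injective ∘ reciprocal-injective) (reciprocal≉0 ∘ e)

    w∈columns : ∀ s → InSpan (columns (leftCirculant f)) (w s)
    w∈columns s = reciprocalPowers∈columns f (e s) (proj₁ (proj₂ (proj₂ (select nonroot?))) s)

    missed⇒root : ∀ k → (∀ s → e s ≢ k) → value f (nonzero k) ≈ 0#
    missed⇒root k missed = decidable-stable (value f (nonzero k) ≟ 0#)
      (λ D≉0 → let s , es≡k = proj₂ (proj₂ (proj₂ (select nonroot?))) k D≉0 in missed s es≡k)

    columns∈w : ∀ j → InSpan w (columns (leftCirculant f) j)
    -- At a root the factor `value f (nonzero k)` kills the term, so the expansion over all nonzero
    -- elements shrinks to the range of `e`.
    columns∈w j = (λ s → a (e s) * value f (nonzero (e s))) , λ i → sym (trans (proj₂ (column-expansion f j) i)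
      (sum-reindex +-commutativeMonoid e e-injective (λ k → a k * value f (nonzero k) * reciprocal k ^ toℕ i)
        (λ k missed → trans (*-congʳ (trans (*-congˡ (missed⇒root k missed)) (zeroʳ _))) (zeroˡ _))))
      where
      a : Vector Carrier n
      a = proj₁ (column-expansion f j)

  -- Comparing the zeros of R_γ and S_γ away from 0

  module _ (g : P₁.Poly) (degree : ∀ i → n < i → P₁.coeff g i ≈ 0#) where

    private
      a : ℕ → Carrier
      a = P₁.coeff g

      eval-g : ∀ x → P₁.eval g x ≈ a 0 + sum {n} (λ i → a (suc (toℕ i)) * (x * x ^ toℕ i))
      eval-g x = trans (eval≈sum q g x degree) (+-congʳ (*-identityʳ _))

    eval-at-0 : ∀ {x} → x ≈ 0# → P₁.eval g x ≈ a 0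
    eval-at-0 {x} x≈0 = trans (eval-g x) (trans (+-congˡ (sum-zero +-commutativeMonoid {n} _ (λ i →
      trans (*-congˡ {a (suc (toℕ i))} (trans (*-congʳ {x ^ toℕ i} x≈0) (zeroˡ _))) (zeroʳ _)))) (+-identityʳ _))

    eval-vanishing-constant : a 0 ≈ 0# → ∀ x → P₁.eval g x ≈ x * value (drop 1 g) x
    eval-vanishing-constant a₀≈0 x = begin
      P₁.eval g x
        ≈⟨ trans (eval-g x) (trans (+-congʳ a₀≈0) (+-identityˡ _)) ⟩
      sum {n} (λ i → a (suc (toℕ i)) * (x * x ^ toℕ i))
        ≈⟨ sum-cong-≋ {n} (λ i → trans (x∙yz≈y∙xz (a (suc (toℕ i))) x (x ^ toℕ i)) (*-congˡ (*-congʳ (reflexive (coeff-drop g (toℕ i)))))) ⟩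
      sum {n} (λ i → x * (P₁.coeff (drop 1 g) (toℕ i) * x ^ toℕ i))
        ≈⟨ *-distribˡ-sum {n} x (λ i → P₁.coeff (drop 1 g) (toℕ i) * x ^ toℕ i) ⟨
      x * value (drop 1 g) x ∎
      where
      coeff-drop : ∀ p i → P₁.coeff p (suc i) ≡ P₁.coeff (drop 1 p) i
      coeff-drop []      i = ≡.refl
      coeff-drop (_ ∷ p) i = ≡.refl

    -- As x^n = 1, the top coefficient can be folded into the constant term. The separate sequence
    -- `b` is there because `S` is written with the values aᵢ(γ), which are only `≈` to the
    -- coefficients of the specialised list.
    eval-wrapped : ∀ (b : ℕ → Carrier) → (∀ i → b i ≈ a i) → ∀ {x} → ¬ x ≈ 0# →
                   P₁.eval g x ≈ value ((b 0 + b n) ∷ applyUpTo (b ∘ suc) m) x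
    eval-wrapped b b≈a {x} x≉0 = begin
      P₁.eval g x
        ≈⟨ eval-g x ⟩
      a 0 + sum {n} (λ i → a (suc (toℕ i)) * x ^ suc (toℕ i))
        ≈⟨ +-congˡ (sum-init-last {m} (λ i → a (suc (toℕ i)) * x ^ suc (toℕ i))) ⟩
      a 0 + (sum {m} (λ i → a (suc (toℕ (inject₁ i))) * x ^ suc (toℕ (inject₁ i))) + a (suc (toℕ (fromℕ m))) * x ^ suc (toℕ (fromℕ m)))
        ≈⟨ +-congˡ (+-cong (sum-cong-≋ {m} middle) top) ⟩
      a 0 + (sum {m} (λ i → P₁.coeff (applyUpTo (b ∘ suc) m) (toℕ i) * x ^ suc (toℕ i)) + b n)
        ≈⟨ trans (+-congʳ (sym (b≈a 0))) (trans (+-congˡ (+-comm _ _)) (sym (+-assoc _ _ _))) ⟩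
      b 0 + b n + sum {m} (λ i → P₁.coeff (applyUpTo (b ∘ suc) m) (toℕ i) * x ^ suc (toℕ i))
        ≈⟨ +-congʳ (*-identityʳ _) ⟨
      value ((b 0 + b n) ∷ applyUpTo (b ∘ suc) m) x ∎
      where
      coeff-applyUpTo : ∀ (c : ℕ → Carrier) {N} (i : Fin N) → P₁.coeff (applyUpTo c N) (toℕ i) ≡ c (toℕ i)
      coeff-applyUpTo c zero    = ≡.refl
      coeff-applyUpTo c (suc i) = coeff-applyUpTo (c ∘ suc) i

      middle : ∀ i → a (suc (toℕ (inject₁ i))) * x ^ suc (toℕ (inject₁ i)) ≈
                     P₁.coeff (applyUpTo (b ∘ suc) m) (toℕ i) * x ^ suc (toℕ i)
      middle i = trans (reflexive (≡.cong (λ k → a (suc k) * x ^ suc k) (toℕ-inject₁ i)))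
        (*-congʳ (trans (sym (b≈a _)) (reflexive (≡.sym (coeff-applyUpTo (b ∘ suc) i)))))

      top : a (suc (toℕ (fromℕ m))) * x ^ suc (toℕ (fromℕ m)) ≈ b n
      top = trans (reflexive (≡.cong (λ k → a (suc k) * x ^ suc k) (toℕ-fromℕ m)))
        (trans (*-congˡ (b^n≈1 x≉0)) (trans (*-identityʳ _) (sym (b≈a n))))

  -- Counting zeros

  rootCount : P₁.Poly → ℕ
  rootCount g = ∑ℕ.sum {q} (λ k → 𝟙 (P₁.eval g (from k) ≟ 0#))

  -- On the nonzero elements the roots of `g` are those of `f`, and the rank counts the others, so
  -- together they give `n`. The element 0 adds one exactly when the constant coefficient vanishes.
  rootCount+rank : ∀ g → (∀ i → n < i → P₁.coeff g i ≈ 0#) → ∀ f →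
    (∀ x → ¬ x ≈ 0# → P₁.eval g x ≈ 0# ⇔ value f x ≈ 0#) →
    ∀ ρ → HasRank (leftCirculant f) ρ → rootCount g ℕ.+ ρ ≡ n ℕ.+ 𝟙 (P₁.coeff g 0 ≟ 0#)
  rootCount+rank g degree f g⇔f ρ hasRank = ≡R.begin
    rootCount g ℕ.+ ρ
      ≡R.≡⟨ ≡.cong₂ ℕ._+_ (∑ℕ.sum-remove {i = to 0#} (λ k → 𝟙 (P₁.eval g (from k) ≟ 0#))) (rank-leftCirculant f ρ hasRank) ⟩
    𝟙 (P₁.eval g (from (to 0#)) ≟ 0#) ℕ.+ ∑ℕ.sum {n} (λ k → 𝟙 (P₁.eval g (nonzero k) ≟ 0#)) ℕ.+ nonroots
      ≡R.≡⟨ ≡.cong₂ (λ a b → a ℕ.+ b ℕ.+ nonroots) (𝟙-cong at0 (P₁.eval g (from (to 0#)) ≟ 0#) (P₁.coeff g 0 ≟ 0#))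
           (∑ℕ.sum-cong-≗ {n} λ k → 𝟙-cong (g⇔f (nonzero k) (nonzero≉0 k)) (P₁.eval g (nonzero k) ≟ 0#) (value f (nonzero k) ≟ 0#)) ⟩
    𝟙 (P₁.coeff g 0 ≟ 0#) ℕ.+ roots ℕ.+ nonroots
      ≡R.≡⟨ ℕ.+-assoc (𝟙 (P₁.coeff g 0 ≟ 0#)) roots nonroots ⟩
    𝟙 (P₁.coeff g 0 ≟ 0#) ℕ.+ (roots ℕ.+ nonroots)
      ≡R.≡⟨ ≡.cong (𝟙 (P₁.coeff g 0 ≟ 0#) ℕ.+_) roots+nonroots ⟩
    𝟙 (P₁.coeff g 0 ≟ 0#) ℕ.+ n
      ≡R.≡⟨ ℕ.+-comm (𝟙 (P₁.coeff g 0 ≟ 0#)) n ⟩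
    n ℕ.+ 𝟙 (P₁.coeff g 0 ≟ 0#) ≡R.∎
    where
    module ≡R = ≡.≡-Reasoning

    roots nonroots : ℕ
    roots = ∑ℕ.sum {n} (λ k → 𝟙 (value f (nonzero k) ≟ 0#))
    nonroots = ∑ℕ.sum {n} (λ k → 𝟙 (¬? (value f (nonzero k) ≟ 0#)))

    roots+nonroots : roots ℕ.+ nonroots ≡ n
    roots+nonroots = ≡.trans (≡.sym (∑ℕ.∑-distrib-+ {n} (λ k → 𝟙 (value f (nonzero k) ≟ 0#)) (λ k → 𝟙 (¬? (value f (nonzero k) ≟ 0#)))))
      (≡.trans (∑ℕ.sum-cong-≗ {n} (λ k → 𝟙+𝟙¬≡1 (value f (nonzero k) ≟ 0#)))
        (≡.trans (sum-const n 1) (ℕ.*-identityʳ n)))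

    at0 : P₁.eval g (from (to 0#)) ≈ 0# ⇔ P₁.coeff g 0 ≈ 0#
    at0 = mk⇔ (trans (sym (eval-at-0 g degree (strictlyInverseʳ 0#)))) (trans (eval-at-0 g degree (strictlyInverseʳ 0#)))

  module _ (R : P₂.Poly) (degree : P₂.DegreeAtMost n R) (γ : Carrier) where

    private
      g : P₁.Poly
      g = R ⟨Y, γ ⟩

      coeff-g : ∀ i → P₁.coeff g i ≈ a⟨ i ⟩ R γ
      coeff-g = coeff-map 𝔽[T] K (λ a → P₁.eval a γ) refl R

      degree-g : ∀ i → n < i → P₁.coeff g i ≈ 0#
      degree-g i n<i = trans (coeff-g i) (eval-zero (P₂.coeff R i) γ (degree i n<i))

      -- `S` with its decision made a parameter, so that `S-root` can split on it; at the decision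
      -- `a⟨ 0 ⟩ R γ ≟ 0#` it computes to `S R γ`.
      S-by : Dec (a⟨ 0 ⟩ R γ ≈ 0#) → P₁.Poly
      S-by a₀≟0 = if does a₀≟0
        then drop 1 g
        else ((a⟨ 0 ⟩ R γ + a⟨ n ⟩ R γ) ∷ applyUpTo (λ i → a⟨ suc i ⟩ R γ) m)

      S-root : ∀ a₀≟0 x → ¬ x ≈ 0# → P₁.eval g x ≈ 0# ⇔ value (S-by a₀≟0) x ≈ 0#
      S-root (yes a₀≈0) x x≉0 = mk⇔
        (λ root → *-cancelˡ-≉0 x≉0 (trans (sym factor) (trans root (sym (zeroʳ x)))))
        (λ root → trans factor (trans (*-congˡ root) (zeroʳ x)))
        where factor = eval-vanishing-constant g degree-g (trans (coeff-g 0) a₀≈0) x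
      S-root (no _) x x≉0 = mk⇔ (trans (sym wrapped)) (trans wrapped)
        where wrapped = eval-wrapped g degree-g (λ i → a⟨ i ⟩ R γ) (λ i → sym (coeff-g i)) x≉0

    rootCount+rank-S : ∀ ρ → HasRank (leftCirculant (S R γ)) ρ →
                       rootCount (R ⟨Y, γ ⟩) ℕ.+ ρ ≡ n ℕ.+ 𝟙 (a⟨ 0 ⟩ R γ ≟ 0#)
    rootCount+rank-S ρ hasRank = ≡.trans
      (rootCount+rank g degree-g (S R γ) (S-root (a⟨ 0 ⟩ R γ ≟ 0#)) ρ hasRank)
      (≡.cong (n ℕ.+_) (𝟙-cong (mk⇔ (trans (sym (coeff-g 0))) (trans (coeff-g 0))) (P₁.coeff g 0 ≟ 0#) (a⟨ 0 ⟩ R γ ≟ 0#)))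

  -- Substituting γ for Z and β for Y is a ring homomorphism, and it sends Y^q - Y to β^q - β = 0.
  reduction-eval : ∀ G R → IsReduction G R → ∀ β γ → P₁.eval (R ⟨Y, γ ⟩) β ≈ P₁.eval (G ⟨Y, γ ⟩) β
  reduction-eval G R (RawMagmaDefinitions._,_ quotient divides , _) β γ = x∙y⁻¹≈ε⇒x≈y _ _ (begin
    φ R - φ G
      ≈⟨ +-congˡ (φ.-‿homo G) ⟨
    φ R + φ (PR.- G)
      ≈⟨ φ.+-homo R (PR.- G) ⟨
    φ (R PR.+ (PR.- G))
      ≈⟨ φ.⟦⟧-cong {quotient PR.* ((Y ^ᴾ q) PR.+ (PR.- Y))} {R PR.+ (PR.- G)} divides ⟨
    φ (quotient PR.* ((Y ^ᴾ q) PR.+ (PR.- Y)))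
      ≈⟨ φ.*-homo quotient _ ⟩
    φ quotient * φ ((Y ^ᴾ q) PR.+ (PR.- Y))
      ≈⟨ *-congˡ (trans (φ.+-homo (Y ^ᴾ q) (PR.- Y)) (+-cong φYq≈β (trans (φ.-‿homo Y) (-‿cong φY≈β)))) ⟩
    φ quotient * (β - β)
      ≈⟨ trans (*-congˡ (-‿inverseʳ β)) (zeroʳ _) ⟩
    0# ∎)
    where
    module PR = RawRing 𝔽[T][U]
    open RawSemiringDefinitions PR.rawSemiring using () renaming (_^_ to _^ᴾ_)

    Y : P₂.Poly
    Y = P₂.var

    φ : P₂.Poly → Carrier
    φ G = P₁.eval (G ⟨Y, γ ⟩) β

    φ-isHom : IsRingHomomorphism 𝔽[T][U] 𝔽 φ
    φ-isHom = eval-map-isRingHomomorphism 𝔽[T] (eval-isRingHomomorphism γ) β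

    module φ = IsRingHomomorphism φ-isHom

    φY≈β : φ Y ≈ β
    φY≈β = begin
      0# + β * ((1# + γ * 0#) + β * 0#)   ≈⟨ +-identityˡ _ ⟩
      β * ((1# + γ * 0#) + β * 0#)        ≈⟨ *-congˡ (+-cong (+-congˡ (zeroʳ γ)) (zeroʳ β)) ⟩
      β * ((1# + 0#) + 0#)                ≈⟨ *-congˡ (trans (+-identityʳ _) (+-identityʳ _)) ⟩
      β * 1#                              ≈⟨ *-identityʳ β ⟩
      β                                   ∎

    φYq≈β : φ (Y ^ᴾ q) ≈ β
    φYq≈β = trans (^-homo 𝔽[T][U] φ-isHom Y q) (trans (^-congˡ q φY≈β) (b^q≈b β))

  -- Summing over the roots of P(0,Z)

  module _ (P : P₂.Poly) (Q : P₃.Poly) {r} (γ : Fin r → Carrier) (γ-injective : Injective _≡_ _≈_ γ)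
           (γ-roots : ∀ x → P₁.eval (P⟨0,Z⟩ P) x ≈ 0# ⇔ (∃[ j ] γ j ≈ x))
           (R : P₂.Poly) (reduction : IsReduction (Q⟨0,Y,Z⟩ Q) R) where

    private
      zero? : ∀ ((β , γ) : Carrier × Carrier) →
              Dec (P₁.eval (P⟨0,Z⟩ P) γ ≈ 0# × P₁.eval (Q⟨0,Y,Z⟩ Q ⟨Y, γ ⟩) β ≈ 0#)
      zero? (β , γ) = (P₁.eval (P⟨0,Z⟩ P) γ ≟ 0#) ×-dec (P₁.eval (Q⟨0,Y,Z⟩ Q ⟨Y, γ ⟩) β ≟ 0#)

      index : Fin r → Fin q
      index = to ∘ γ

      index-injective : Injective _≡_ _≡_ index
      index-injective = γ-injective ∘ to-injective

      zerosAbove : Fin q → ℕ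
      zerosAbove k = ∑ℕ.sum {q} (λ i → 𝟙 (zero? (from i , from k)))

      zerosAbove-nonroot : ∀ k → (∀ j → index j ≢ k) → zerosAbove k ≡ 0
      zerosAbove-nonroot k missed = sum-zero ℕ.+-0-commutativeMonoid {q} _ (λ i → 𝟙-false (zero? (from i , from k))
        (λ (root , _) → let j , γj≈ = Equivalence.to (γ-roots (from k)) root in
          missed j (≡.trans (to-cong γj≈) (strictlyInverseˡ k))))

      zerosAbove-root : ∀ j → zerosAbove (index j) ≡ rootCount (R ⟨Y, γ j ⟩)
      zerosAbove-root j = ∑ℕ.sum-cong-≗ {q} (λ i → 𝟙-cong
        (mk⇔ (λ (_ , Q≈0) → trans (agree i) Q≈0)
             (λ R≈0 → Equivalence.from (γ-roots (from (index j))) (j , sym (strictlyInverseʳ (γ j))) , trans (sym (agree i)) R≈0))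
        (zero? (from i , from (index j))) (P₁.eval (R ⟨Y, γ j ⟩) (from i) ≟ 0#))
        where
        -- `from (index j)` is only `≈` to `γ j`, so the evaluation point in Z has to be transported
        -- besides reducing `Q⟨0,Y,Z⟩ Q` to `R`.
        agree : ∀ i → P₁.eval (R ⟨Y, γ j ⟩) (from i) ≈ P₁.eval (Q⟨0,Y,Z⟩ Q ⟨Y, from (index j) ⟩) (from i)
        agree i = trans (reduction-eval (Q⟨0,Y,Z⟩ Q) R reduction (from i) (γ j))
          (eval-map-cong (λ a → eval-congʳ a (sym (strictlyInverseʳ (γ j)))) (Q⟨0,Y,Z⟩ Q) (from i))

    -- The product list runs over β outermost; exchanging the sums groups the zeros by their second
    -- coordinate. The groups over non-roots of P(0,Z) are empty, and `index` lists the remaining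
    -- ones.
    N₀′≡∑rootCount : N₀′ P Q ≡ ∑ℕ.sum (λ j → rootCount (R ⟨Y, γ j ⟩))
    N₀′≡∑rootCount = ≡R.begin
      length (filter zero? (cartesianProduct elements elements))
        ≡R.≡⟨ ≡.cong (λ xs → length (filter zero? (cartesianProduct xs xs))) (map-tabulate id from) ⟩
      length (filter zero? (cartesianProduct (tabulate from) (tabulate from)))
        ≡R.≡⟨ length-filter-cartesianProduct zero? from from ⟩
      ∑ℕ.sum (λ i → ∑ℕ.sum (λ k → 𝟙 (zero? (from i , from k))))
        ≡R.≡⟨ ∑ℕ.∑-comm (λ i k → 𝟙 (zero? (from i , from k))) ⟩
      ∑ℕ.sum zerosAbove
        ≡R.≡⟨ sum-reindex ℕ.+-0-commutativeMonoid index index-injective zerosAbove zerosAbove-nonroot ⟩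
      ∑ℕ.sum (zerosAbove ∘ index)
        ≡R.≡⟨ ∑ℕ.sum-cong-≗ zerosAbove-root ⟩
      ∑ℕ.sum (λ j → rootCount (R ⟨Y, γ j ⟩)) ≡R.∎
      where module ≡R = ≡.≡-Reasoning

    N₀′+∑ρ : ∀ t → t ≤ r → (∀ j → toℕ j < t → a⟨ 0 ⟩ R (γ j) ≈ 0#) → (∀ j → t ≤ toℕ j → ¬ (a⟨ 0 ⟩ R (γ j) ≈ 0#)) →
             (ρ : Fin r → ℕ) → (∀ j → HasRank (leftCirculant (S R (γ j))) (ρ j)) →
             N₀′ P Q ℕ.+ Σℕ ρ ≡ r ℕ.* n ℕ.+ t
    N₀′+∑ρ t t≤r below above ρ hasRank = ≡R.begin
      N₀′ P Q ℕ.+ Σℕ ρ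
        ≡R.≡⟨ ≡.cong (ℕ._+ Σℕ ρ) N₀′≡∑rootCount ⟩
      ∑ℕ.sum (λ j → rootCount (R ⟨Y, γ j ⟩)) ℕ.+ ∑ℕ.sum ρ
        ≡R.≡⟨ ∑ℕ.∑-distrib-+ (λ j → rootCount (R ⟨Y, γ j ⟩)) ρ ⟨
      ∑ℕ.sum (λ j → rootCount (R ⟨Y, γ j ⟩) ℕ.+ ρ j)
        ≡R.≡⟨ ∑ℕ.sum-cong-≗ (λ j → rootCount+rank-S R (proj₂ reduction) (γ j) (ρ j) (hasRank j)) ⟩
      ∑ℕ.sum {r} (λ j → n ℕ.+ 𝟙 (a⟨ 0 ⟩ R (γ j) ≟ 0#))
        ≡R.≡⟨ ∑ℕ.∑-distrib-+ {r} (λ _ → n) (λ j → 𝟙 (a⟨ 0 ⟩ R (γ j) ≟ 0#)) ⟩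
      ∑ℕ.sum {r} (λ _ → n) ℕ.+ ∑ℕ.sum (λ j → 𝟙 (a⟨ 0 ⟩ R (γ j) ≟ 0#))
        ≡R.≡⟨ ≡.cong₂ ℕ._+_ (sum-const r n) (sum-𝟙-initial (λ j → a⟨ 0 ⟩ R (γ j) ≟ 0#) t t≤r below above) ⟩
      r ℕ.* n ℕ.+ t ≡R.∎
      where module ≡R = ≡.≡-Reasoning

-- An empty carrier has no 0. In a one-element ring 0 is its own inverse, so 0 - 0 would be
-- invertible and 0 apart from itself.
finite-nontrivial : ∀ {c ℓ₁ ℓ₂} (F : HeytingField c ℓ₁ ℓ₂) {q} → Inverse (fieldSetoid F) (setoid (Fin q)) →
                    ∃[ m ] q ≡ suc (suc m)
finite-nontrivial F {zero}        enumeration = contradiction (Inverse.to enumeration (HeytingField.0# F)) λ ()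
finite-nontrivial F {suc (suc m)} enumeration = m , ≡.refl
finite-nontrivial F {suc zero}    enumeration = contradiction
  (HeytingField.invertible⇒# F {0#} {0#} (0# , inverts , inverts))
  (HeytingField.#-irrefl F refl)
  where
  open CommutativeRing (HeytingCommutativeRing.commutativeRing (HeytingField.heytingCommutativeRing F))

  to-constant : ∀ (i j : Fin 1) → i ≡ j
  to-constant Fin.zero Fin.zero = ≡.refl

  inverts : ∀ {x} → x ≈ 1#
  inverts {x} = trans (sym (Inverse.strictlyInverseʳ enumeration x))
    (trans (Inverse.from-cong enumeration (to-constant _ _)) (Inverse.strictlyInverseʳ enumeration 1#))

move-to-difference : ∀ {a b c d} → a ℕ.+ b ≡ c ℕ.+ d → + a ≡ + c ℤ.- + b ℤ.+ + d
move-to-difference {a} {b} {c} {d} eq = begin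
  + a                            ≡⟨ ℤ.+-identityʳ (+ a) ⟨
  + a ℤ.+ ℤ.0ℤ                   ≡⟨ ≡.cong (λ k → + a ℤ.+ k) (ℤ.+-inverseʳ (+ b)) ⟨
  + a ℤ.+ (+ b ℤ.- + b)          ≡⟨ ℤ.+-assoc (+ a) (+ b) (ℤ.- + b) ⟨
  + (a ℕ.+ b) ℤ.- + b            ≡⟨ ≡.cong (λ k → + k ℤ.- + b) eq ⟩
  + c ℤ.+ + d ℤ.- + b            ≡⟨ ℤ.+-assoc (+ c) (+ d) (ℤ.- + b) ⟩
  + c ℤ.+ (+ d ℤ.- + b)          ≡⟨ ≡.cong (λ k → + c ℤ.+ k) (ℤ.+-comm (+ d) (ℤ.- + b)) ⟩
  + c ℤ.+ (ℤ.- + b ℤ.+ + d)      ≡⟨ ℤ.+-assoc (+ c) (ℤ.- + b) (+ d) ⟨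
  + c ℤ.- + b ℤ.+ + d            ∎
  where open ≡.≡-Reasoning

open import Data.Nat.Base using (_*_)

theorem4p16 : ∀ {c ℓ₁ ℓ₂} (F : HeytingField c ℓ₁ ℓ₂)
    {q : ℕ} (enumeration : Inverse (fieldSetoid F) (setoid (Fin q))) →
    let open FiniteField F enumeration in
    (P : P₂.Poly) (degP : ℕ) → 2 ≤ degP → P₂.MonicOfDegree degP P →
    (Q : P₃.Poly) (degQ : ℕ) → 2 ≤ degQ → P₃.MonicOfDegree degQ Q →
    (r : ℕ) (γ : Fin r → Carrier) → Injective _≡_ _≈_ γ →
    (∀ x → P₁.eval (P⟨0,Z⟩ P) x ≈ 0# ⇔ (∃[ j ] γ j ≈ x)) →
    (R : P₂.Poly) → IsReduction (Q⟨0,Y,Z⟩ Q) R →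
    (t : ℕ) → t ≤ r →
    (∀ j → toℕ j < t → a⟨ 0 ⟩ R (γ j) ≈ 0#) →
    (∀ j → t ≤ toℕ j → ¬ (a⟨ 0 ⟩ R (γ j) ≈ 0#)) →
    (ρ : Fin r → ℕ) → (∀ j → HasRank (leftCirculant (S R (γ j))) (ρ j)) →
    + N₀′ P Q ≡ + (r * (q ∸ 1)) ℤ.- + Σℕ ρ ℤ.+ + t
theorem4p16 F enumeration P _ _ _ Q _ _ _ r γ γ-injective γ-roots R reduction t t≤r below above ρ hasRank
  with finite-nontrivial F enumeration
-- Matching on the equation lets `q ∸ 1` compute to `suc m`, the form in which the additive identity
-- is stated.
... | m , ≡.refl = move-to-difference
  (FiniteFieldTheory.N₀′+∑ρ F enumeration P Q γ γ-injective γ-roots R reduction t t≤r below above ρ hasRank)
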